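{- Let $d\ge1$ be an integer and let $h(z_1,\dots,z_d)=\sum_{k\in[n]^d}c_kz_1^{k_1}\cdots z_d^{k_d}$ be a nonzero polynomial with each $c_k\in\{0,\pm1\}$. Then for any $L\ge1$, $$\max_{z_1,\dots,z_d\in\gamma(L)}|h(z_1,\dots,z_d)|\ \ge\ e^{ -O(Ln\log n)},$$ where the constant implied by $O(\cdot)$ depends only on $d$.
   Context: $[n]=\{0,1,\dots,n-1\}$, and for $L\ge1$, $\gamma(L)=\{e^{i\theta}:-\pi/L\le\theta\le\pi/L\}\subset\mathbb{C}$. -}

module Defs where

open import Level using (_⊔_; suc)
open import Algebra.Apartness.Bundles using (HeytingField)
open import Algebra.Bundles using (CommutativeRing)
open import Algebra.Bundles.Raw using (RawRing)
import Algebra.Apartness.Properties.HeytingCommutativeRing as HeytingProperties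
import Algebra.Definitions.RawSemiring as RawSemiringDefinitions
import Algebra.Properties.Ring as RingProperties
open import Data.Empty using (⊥-elim)
open import Data.Fin.Base using (Fin; toℕ)
open import Data.Integer.Base using (ℤ; +_; -[1+_])
open import Data.Nat.Base as ℕ using (ℕ; NonZero; _!)
open import Data.Nat.Properties using (_!≢0)
open import Data.Product.Base using (∃-syntax; _×_; _,_; proj₁; proj₂)
open import Data.Sum.Base using (_⊎_; inj₁; inj₂)
open import Data.Vec.Base using (Vec; []; _∷_; lookup)
open import Function.Bundles using (_⇔_; Equivalence)
open import Relation.Binary.Core using (Rel)
open import Relation.Binary.Structures using (IsStrictPartialOrder)
open import Relation.Nullary.Negation using (¬_)

-- The standard library has no real numbers, so they are axiomatised as a
-- Cauchy-complete Archimedean ordered field. Classically these axioms have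
-- exactly one model up to isomorphism, namely ℝ. Neither trichotomy nor any
-- other classical principle is assumed, so constructive (Bishop) reals are
-- also a model. Apartness, x # y, means x < y or y < x; the field inverse
-- exists for numbers apart from 0, and equality is the negation of apartness.

record RealNumbers c ℓ₁ ℓ₂ : Set (suc (c ⊔ ℓ₁ ⊔ ℓ₂)) where
  field
    heytingField : HeytingField c ℓ₁ ℓ₂

  open HeytingField heytingField public

  infix 4 _<_ _≤_

  field
    _<_                  : Rel Carrier ℓ₂
    isStrictPartialOrder : IsStrictPartialOrder _≈_ _<_
    #⇔<⊎>                : ∀ {x y} → (x # y) ⇔ (x < y ⊎ y < x)
    +-monoˡ-<            : ∀ z {x y} → x < y → x + z < y + z
    *-positive           : ∀ {x y} → 0# < x → 0# < y → 0# < x * y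

  _≤_ : Rel Carrier ℓ₂
  x ≤ y = ¬ (y < x)

  commutativeRing : CommutativeRing c ℓ₁
  commutativeRing = record { isCommutativeRing = isCommutativeRing }

  open RawSemiringDefinitions
    (RawRing.rawSemiring (CommutativeRing.rawRing commutativeRing)) public
    using () renaming (_×_ to _·_)

  fromℕ : ℕ → Carrier
  fromℕ n = n · 1#

  IsCauchy : (ℕ → Carrier) → Set (c ⊔ ℓ₂)
  IsCauchy u =
    ∀ ε → 0# < ε → ∃[ N ] ∀ m n → N ℕ.≤ m → N ℕ.≤ n → u m < u n + ε

  infix 4 _⟶_

  _⟶_ : (ℕ → Carrier) → Carrier → Set (c ⊔ ℓ₂)
  u ⟶ x =
    ∀ ε → 0# < ε → ∃[ N ] ∀ n → N ℕ.≤ n → (u n < x + ε) × (x < u n + ε)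

  field
    archimedean : ∀ x → ∃[ n ] x < fromℕ n
    complete    : ∀ u → IsCauchy u → ∃[ x ] u ⟶ x

module Analysis {c ℓ₁ ℓ₂} (ℝ : RealNumbers c ℓ₁ ℓ₂) where

  open RealNumbers ℝ public

  private
    module < = IsStrictPartialOrder isStrictPartialOrder
    open HeytingProperties heytingCommutativeRing
      using (1#0; x-0≈x)
    open RingProperties (CommutativeRing.ring commutativeRing)
      using (-‿distribˡ-*; -‿distribʳ-*; -‿involutive)

  0<1 : 0# < 1#
  0<1 with Equivalence.to #⇔<⊎> 1#0
  ... | inj₂ 0<1 = 0<1
  ... | inj₁ 1<0 = ⊥-elim (<.irrefl refl (<.trans 1<0 0<1′))
    where
    0<-1 : 0# < - 1#
    0<-1 = <.<-respˡ-≈ (-‿inverseʳ 1#)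
      (<.<-respʳ-≈ (+-identityˡ (- 1#)) (+-monoˡ-< (- 1#) 1<0))

    0<1′ : 0# < 1#
    0<1′ = <.<-respʳ-≈
      (trans (sym (-‿distribˡ-* 1# (- 1#)))
        (trans (-‿cong (*-identityˡ (- 1#))) (-‿involutive 1#)))
      (*-positive 0<-1 0<-1)

  fromℕ-positive : ∀ n → .{{NonZero n}} → 0# < fromℕ n
  fromℕ-positive (ℕ.suc ℕ.zero)    = <.<-respʳ-≈ (sym (+-identityʳ 1#)) 0<1
  fromℕ-positive (ℕ.suc (ℕ.suc n)) = <.trans (fromℕ-positive (ℕ.suc n))
    (<.<-respˡ-≈ (+-identityˡ _) (+-monoˡ-< (fromℕ (ℕ.suc n)) 0<1))

  1≤x⇒0<x : ∀ {x} → 1# ≤ x → 0# < x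
  1≤x⇒0<x {x} 1≤x with #-cotrans (Equivalence.from #⇔<⊎> (inj₁ 0<1)) x
  ... | inj₁ 0#x with Equivalence.to #⇔<⊎> 0#x
  ...   | inj₁ 0<x = 0<x
  ...   | inj₂ x<0 = ⊥-elim (1≤x (<.trans x<0 0<1))
  1≤x⇒0<x {x} 1≤x | inj₂ x#1 with Equivalence.to #⇔<⊎> x#1
  ...   | inj₁ x<1 = ⊥-elim (1≤x x<1)
  ...   | inj₂ 1<x = <.trans 0<1 1<x

  -- The library's inverse for x # 0# is that of x - 0#.
  recip : ∀ x → 0# < x → Carrier
  recip x 0<x = proj₁ (#⇒invertible (Equivalence.from #⇔<⊎> (inj₂ 0<x)))

  recip-inverseʳ : ∀ x (0<x : 0# < x) → x * recip x 0<x ≈ 1#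
  recip-inverseʳ x 0<x = trans
    (*-congʳ (sym (x-0≈x x)))
    (proj₂ (proj₂ (#⇒invertible (Equivalence.from #⇔<⊎> (inj₂ 0<x)))))

  1/_! : ℕ → Carrier
  1/ k ! = recip (fromℕ (k !)) (fromℕ-positive (k !) {{k !≢0}})

  infix 6 _+i_

  record ℂ : Set c where
    constructor _+i_
    field
      re im : Carrier

  open ℂ public

  ℂ-rawRing : RawRing c ℓ₁
  ℂ-rawRing = record
    { Carrier = ℂ
    ; _≈_     = λ z w → (re z ≈ re w) × (im z ≈ im w)
    ; _+_     = λ z w → (re z + re w) +i (im z + im w)
    ; _*_     = λ z w → (re z * re w + - (im z * im w)) +i
                        (re z * im w + im z * re w)
    ; -_      = λ z → (- re z) +i (- im z)
    ; 0#      = 0# +i 0#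
    ; 1#      = 1# +i 0#
    }

  module ℂ-Ring where
    open RawRing ℂ-rawRing public hiding (Carrier)
    open RawSemiringDefinitions (RawRing.rawSemiring ℂ-rawRing) public
      using (_^_; sum; product) renaming (_×_ to _·_)

  ofReal : Carrier → ℂ
  ofReal x = x +i 0#

  ofℤ : ℤ → ℂ
  ofℤ (+ n)    = n ℂ-Ring.· ℂ-Ring.1#
  ofℤ -[1+ n ] = ℂ-Ring.- (ℕ.suc n ℂ-Ring.· ℂ-Ring.1#)

  IsModulus : ℂ → Carrier → Set (ℓ₁ ⊔ ℓ₂)
  IsModulus z r = (0# ≤ r) × (r * r ≈ re z * re z + im z * im z)

  -- Transcendental functions are given by their graphs: IsExp w z says that z
  -- is the sum of the exponential series at w.

  expPartialSum : ℂ → ℕ → ℂ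
  expPartialSum w N = ℂ-Ring.sum {N} λ k →
    ofReal (1/ toℕ k !) ℂ-Ring.* (w ℂ-Ring.^ toℕ k)

  IsExp : ℂ → ℂ → Set (c ⊔ ℓ₂)
  IsExp w z = ((λ N → re (expPartialSum w N)) ⟶ re z)
            × ((λ N → im (expPartialSum w N)) ⟶ im z)

  IsRealExp : Carrier → Carrier → Set (c ⊔ ℓ₂)
  IsRealExp x y = IsExp (ofReal x) (ofReal y)

  IsLog : Carrier → Carrier → Set (c ⊔ ℓ₂)
  IsLog x y = IsRealExp y x

  -- z = e^{iθ}
  IsCis : Carrier → ℂ → Set (c ⊔ ℓ₂)
  IsCis θ z = IsExp (0# +i θ) z

  IsSin : Carrier → Carrier → Set (c ⊔ ℓ₂)
  IsSin θ s = ∃[ t ] IsCis θ (t +i s)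

  -- π is the least positive zero of sin.
  IsPi : Carrier → Set (c ⊔ ℓ₂)
  IsPi π = (0# < π) × IsSin π 0# × (∀ x → 0# < x → IsSin x 0# → π ≤ x)

  -- The arc γ(L) = { e^{iθ} : -π/L ≤ θ ≤ π/L }, as a predicate.
  γ : (π L : Carrier) → 1# ≤ L → ℂ → Set (c ⊔ ℓ₂)
  γ π L 1≤L z = ∃[ θ ] (- π/L ≤ θ) × (θ ≤ π/L) × IsCis θ z
    where
    π/L : Carrier
    π/L = π * recip L (1≤x⇒0<x 1≤L)

  -- The value of Σ_{k ∈ [n]^d} c_k z₁^{k₁} ⋯ z_d^{k_d}.

  sumOver : ∀ {n} d → (Vec (Fin n) d → ℂ) → ℂ
  sumOver ℕ.zero    f = f []
  sumOver (ℕ.suc d) f = ℂ-Ring.sum λ i → sumOver d (λ k → f (i ∷ k))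

  monomial : ∀ {n d} → Vec (Fin n) d → (Fin d → ℂ) → ℂ
  monomial k z = ℂ-Ring.product λ i → z i ℂ-Ring.^ toℕ (lookup k i)

  evaluate : ∀ {n d} → (Vec (Fin n) d → ℤ) → (Fin d → ℂ) → ℂ
  evaluate {d = d} a z = sumOver d λ k → ofℤ (a k) ℂ-Ring.* monomial k z

  -- max_{z ∈ S} |f z| ≥ b: some point of S has |f z| ≥ b.
  MaxModulus≥ : ∀ {a s} {A : Set a} → (A → Set s) → (A → ℂ) → Carrier →
                Set (a ⊔ s ⊔ c ⊔ ℓ₁ ⊔ ℓ₂)
  MaxModulus≥ S f b = ∃[ z ] S z × ∃[ r ] IsModulus (f z) r × (b ≤ r)

{-# OPTIONS --safe #-}

-- It suffices to let each variable range over the n points z_j = e^{iθ_j} with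
-- θ_j = jκ/(nL), which lie on the arc and satisfy |z_i - z_j| ≥ κ/(2nL).
-- In one variable, dividing f - f(w) by X - w and inducting on the degree bounds
-- every coefficient of f by (O(nL))^n times the largest |f(z_j)|. Iterating over
-- the variables, and starting from a coefficient of modulus 1, some grid point has
-- |h| ≥ (O(nL))^{-dn}. As L ≤ 2L log n and n = e^{log n}, this is e^{-O(Ln log n)}
-- once n ≥ 2; for n = 1 the polynomial is constant.
-- Squared moduli are used throughout, so that a square root is taken only once, of
-- the positive number |h(z)|². Maxima are not attained constructively; the grid point
-- is found by comparing each value with two distinct thresholds.

module Submission where

open import Defs
open import Data.Fin using (Fin)
open import Data.Integer using (ℤ; 0ℤ; 1ℤ; -1ℤ)
open import Data.Nat as ℕ using (ℕ)
open import Data.Product using (∃-syntax; _×_)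
open import Data.Sum using (_⊎_)
open import Data.Vec using (Vec)
open import Relation.Binary.PropositionalEquality using (_≡_; _≢_)

open import Algebra.Bundles using (CommutativeRing; RawRing)
import Algebra.Properties.AbelianGroup as AbelianGroupProperties
import Algebra.Properties.CommutativeSemiring.Exp as Exp
import Algebra.Properties.Ring as RingProperties
import Algebra.Properties.Semiring.Mult as Mult
import Algebra.Properties.Semiring.Sum as Sum
import Algebra.Solver.Ring
open import Algebra.Solver.Ring.AlmostCommutativeRing
  using (fromCommutativeRing; _-Raw-AlmostCommutative⟶_)
open import Data.Empty using (⊥-elim)
open import Data.Fin using (zero; suc; toℕ)
import Data.Fin.Properties as Fin
open import Data.Integer as ℤ using (+_; -[1+_])
import Data.Integer.Properties as ℤ
open import Data.Maybe.Base using (Maybe; map)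
open import Data.Nat using (suc; _!)
import Data.Nat.Properties as ℕ
open import Data.Product using (_,_; proj₁; proj₂)
open import Data.Sum using (inj₁; inj₂; [_,_]′)
open import Data.Vec using ([]; _∷_)
import Data.Vec.Functional as Functional
open import Function using (_∘_)
open import Function.Bundles using (Equivalence)
open import Relation.Binary.Definitions using (tri<; tri≈; tri>)
import Relation.Binary.PropositionalEquality as ≡
import Relation.Binary.Reasoning.Base.Triple as Triple
import Relation.Binary.Reasoning.Setoid as SetoidReasoning
open import Relation.Binary.Structures using (IsPreorder; IsStrictPartialOrder)
open import Relation.Nullary.Decidable.Core using (dec⇒maybe)

-- The exponential and the logarithm are known only through their graphs. For n ≥ 2, the number b is
-- the limit of the exponential series at some -X with X ≥ 0, and b ≤ 1 / Y is wanted for an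
-- explicit product Y of powers of n, L and constants. Two facts about partial sums give it: b times
-- any partial sum at X is at most 1, and some partial sum at X is at least Y. Cauchy products of
-- partial sums provide the first fact and the multiplicativity behind the second, so the
-- exponential of X itself is never formed. The grid points, in contrast, have to be constructed as
-- limits. Their scale is κ = 1 / m for a natural number m ≥ 4 with m π > 1: the angles then stay
-- within the arc, and on them the sine is so close to the identity that the imaginary parts alone
-- separate the points. Since m is determined by π, the constant C depends only on d.

module IntegerCoefficients {c ℓ} (R : CommutativeRing c ℓ) where

  open CommutativeRing R
  open AbelianGroupProperties +-abelianGroup using (⁻¹-∙-comm)
  open Mult semiring using (×-homo-+; ×1-homo-*) renaming (_×_ to _·_)
  open RingProperties ring using (-‿distribˡ-*; -‿distribʳ-*; -‿involutive; -0#≈0#)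
  open SetoidReasoning setoid

  ⟦_⟧ : ℤ → Carrier
  ⟦ + n ⟧      = n · 1#
  ⟦ -[1+ n ] ⟧ = - (suc n · 1#)

  ⟦-⟧-homo : ∀ i → ⟦ ℤ.- i ⟧ ≈ - ⟦ i ⟧
  ⟦-⟧-homo (+ ℕ.zero)  = sym -0#≈0#
  ⟦-⟧-homo (+ suc n)   = refl
  ⟦-⟧-homo -[1+ n ]    = sym (-‿involutive _)

  ⟦⊖⟧-homo : ∀ m n → ⟦ m ℤ.⊖ n ⟧ ≈ m · 1# - n · 1#
  ⟦⊖⟧-homo m ℕ.zero = begin
    m · 1#        ≈⟨ +-identityʳ _ ⟨
    m · 1# + 0#   ≈⟨ +-congˡ -0#≈0# ⟨
    m · 1# - 0#   ∎
  ⟦⊖⟧-homo ℕ.zero (suc n) = sym (+-identityˡ _)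
  ⟦⊖⟧-homo (suc m) (suc n) = begin
    ⟦ suc m ℤ.⊖ suc n ⟧            ≡⟨ ≡.cong ⟦_⟧ (ℤ.[1+m]⊖[1+n]≡m⊖n m n) ⟩
    ⟦ m ℤ.⊖ n ⟧                        ≈⟨ ⟦⊖⟧-homo m n ⟩
    x - y                              ≈⟨ +-congʳ (+-identityˡ x) ⟨
    (0# + x) - y                       ≈⟨ +-congʳ (+-congʳ (-‿inverseʳ 1#)) ⟨
    ((1# - 1#) + x) - y                ≈⟨ +-congʳ (+-assoc _ _ _) ⟩
    (1# + (- 1# + x)) - y              ≈⟨ +-congʳ (+-congˡ (+-comm _ _)) ⟩
    (1# + (x - 1#)) - y                ≈⟨ +-congʳ (+-assoc _ _ _) ⟨
    ((1# + x) - 1#) - y                ≈⟨ +-assoc _ _ _ ⟩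
    (1# + x) + (- 1# - y)              ≈⟨ +-congˡ (⁻¹-∙-comm 1# y) ⟩
    (1# + x) - (1# + y)                ∎
    where
    x = m · 1#
    y = n · 1#

  ⟦+⟧-homo : ∀ i j → ⟦ i ℤ.+ j ⟧ ≈ ⟦ i ⟧ + ⟦ j ⟧
  ⟦+⟧-homo (+ m)    (+ n)    = ×-homo-+ 1# m n
  ⟦+⟧-homo (+ m)    -[1+ n ] = ⟦⊖⟧-homo m (suc n)
  ⟦+⟧-homo -[1+ m ] (+ n)    = trans (⟦⊖⟧-homo n (suc m)) (+-comm _ _)
  ⟦+⟧-homo -[1+ m ] -[1+ n ] = begin
    - (suc (suc (m ℕ.+ n)) · 1#)            ≡⟨ ≡.cong (λ k → - (suc k · 1#)) (ℕ.+-suc m n) ⟨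
    - ((suc m ℕ.+ suc n) · 1#)              ≈⟨ -‿cong (×-homo-+ 1# (suc m) (suc n)) ⟩
    - (suc m · 1# + suc n · 1#)             ≈⟨ ⁻¹-∙-comm _ _ ⟨
    - (suc m · 1#) - suc n · 1#             ∎

  ⟦+*⟧-homo : ∀ m n → ⟦ + m ℤ.* + n ⟧ ≈ m · 1# * n · 1#
  ⟦+*⟧-homo m n = trans
    (reflexive (≡.cong ⟦_⟧ (≡.sym (ℤ.pos-* m n)))) (×1-homo-* m n)

  ⟦*⟧-homo : ∀ i j → ⟦ i ℤ.* j ⟧ ≈ ⟦ i ⟧ * ⟦ j ⟧
  ⟦*⟧-homo (+ m) (+ n) = ⟦+*⟧-homo m n
  ⟦*⟧-homo (+ m) -[1+ n ] = begin
    ⟦ + m ℤ.* -[1+ n ] ⟧          ≡⟨ ≡.cong ⟦_⟧ (ℤ.neg-distribʳ-* (+ m) (+ suc n)) ⟨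
    ⟦ ℤ.- (+ m ℤ.* + suc n) ⟧   ≈⟨ ⟦-⟧-homo (+ m ℤ.* + suc n) ⟩
    - ⟦ + m ℤ.* + suc n ⟧       ≈⟨ -‿cong (⟦+*⟧-homo m (suc n)) ⟩
    - (m · 1# * suc n · 1#)     ≈⟨ -‿distribʳ-* _ _ ⟩
    m · 1# * - (suc n · 1#)     ∎
  ⟦*⟧-homo -[1+ m ] j = begin
    ⟦ -[1+ m ] ℤ.* j ⟧            ≡⟨ ≡.cong ⟦_⟧ (ℤ.neg-distribˡ-* (+ suc m) j) ⟨
    ⟦ ℤ.- (+ suc m ℤ.* j) ⟧     ≈⟨ ⟦-⟧-homo (+ suc m ℤ.* j) ⟩
    - ⟦ + suc m ℤ.* j ⟧         ≈⟨ -‿cong (pos j) ⟩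
    - (suc m · 1# * ⟦ j ⟧)      ≈⟨ -‿distribˡ-* _ _ ⟩
    - (suc m · 1#) * ⟦ j ⟧      ∎
    where
    pos : ∀ j → ⟦ + suc m ℤ.* j ⟧ ≈ suc m · 1# * ⟦ j ⟧
    pos (+ n)    = ⟦+*⟧-homo (suc m) n
    pos -[1+ n ] = ⟦*⟧-homo (+ suc m) -[1+ n ]

  morphism : ℤ.+-*-rawRing -Raw-AlmostCommutative⟶ fromCommutativeRing R
  morphism = record
    { ⟦_⟧    = ⟦_⟧
    ; +-homo = ⟦+⟧-homo
    ; *-homo = ⟦*⟧-homo
    ; -‿homo = ⟦-⟧-homo
    ; 0-homo = refl
    ; 1-homo = +-identityʳ 1#
    }

  ⟦_⟧≟⟦_⟧ : ∀ i j → Maybe (⟦ i ⟧ ≈ ⟦ j ⟧)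
  ⟦ i ⟧≟⟦ j ⟧ = map (λ i≡j → reflexive (≡.cong ⟦_⟧ i≡j)) (dec⇒maybe (i ℤ.≟ j))

  -- Equality in R need not be decidable, so the coefficients are integers: numerals such as
  -- `con (+ 18)` can then be computed with and compared.
  module Solver = Algebra.Solver.Ring ℤ.+-*-rawRing (fromCommutativeRing R) morphism ⟦_⟧≟⟦_⟧

  open Solver public using (solve; _:=_; _:+_; _:*_; _:-_; :-_; _:^_; con)

  -- The numeral con (+ 1) denotes 1# + 0#, which is not 1# on the nose.
  :1 : ∀ {n} → Solver.Polynomial n
  :1 = con 0ℤ :^ 0

-- Polynomials in one variable: Horner values and synthetic division.

module Polynomials {c ℓ} (R : CommutativeRing c ℓ) where

  open CommutativeRing R hiding (zero)
  open IntegerCoefficients R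
  open Exp commutativeSemiring using (_^_)
  open Sum semiring using (sum; sum-cong-≋; *-distribˡ-sum)

  horner : ∀ {n} → (Fin n → Carrier) → Carrier → Carrier
  horner {ℕ.zero} f x = 0#
  horner {suc n}  f x = f zero + x * horner (f ∘ suc) x

  sum≈horner : ∀ {n} (f : Fin n → Carrier) x → sum (λ i → x ^ toℕ i * f i) ≈ horner f x
  sum≈horner {ℕ.zero} f x = refl
  sum≈horner {suc n}  f x = +-cong (*-identityˡ (f zero))
    (trans (sum-cong-≋ {n} (λ i → *-assoc x (x ^ toℕ i) (f (suc i))))
      (trans (sym (*-distribˡ-sum x (λ i → x ^ toℕ i * f (suc i))))
        (*-congˡ (sum≈horner (f ∘ suc) x))))

  -- Synthetic division: the coefficients of (f - f(w)) / (X - w) are the Horner values at w of the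
  -- successive tails of f.
  quotient : ∀ {n} → (Fin (suc n) → Carrier) → Carrier → Fin n → Carrier
  quotient f w zero    = horner (f ∘ suc) w
  quotient f w (suc i) = quotient (f ∘ suc) w i

  -- With f = c + X h, the quotient of f is h(w) + X q for q the quotient of h, and (x - w) h(w) + x
  -- (h(x) - h(w)) = x h(x) - w h(w).
  quotient-correct : ∀ {n} (f : Fin (suc n) → Carrier) w x →
    (x - w) * horner (quotient f w) x ≈ horner f x - horner f w
  quotient-correct {ℕ.zero} f w x = solve 3
    (λ c x w → (x :- w) :* con 0ℤ := (c :+ x :* con 0ℤ) :- (c :+ w :* con 0ℤ)) refl (f zero) x w
  quotient-correct {suc n} f w x = trans
    (solve 4 (λ x w g q → (x :- w) :* (g :+ x :* q) := (x :- w) :* g :+ x :* ((x :- w) :* q))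
      refl x w (horner (f ∘ suc) w) (horner (quotient (f ∘ suc) w) x))
    (trans (+-congˡ (*-congˡ (quotient-correct (f ∘ suc) w x)))
      (solve 5 (λ c x w g h → (x :- w) :* g :+ x :* (h :- g) := (c :+ x :* h) :- (c :+ w :* g))
        refl (f zero) x w (horner (f ∘ suc) w) (horner (f ∘ suc) x)))

  x+y*0≈x : ∀ x y → x + y * 0# ≈ x
  x+y*0≈x = solve 2 (λ x y → x :+ y :* con 0ℤ := x) refl

  [x+y]-y≈x : ∀ x y → (x + y) - y ≈ x
  [x+y]-y≈x = solve 2 (λ x y → (x :+ y) :- y := x) refl

  x*[y*z]≈y*[x*z] : ∀ x y z → x * (y * z) ≈ y * (x * z)
  x*[y*z]≈y*[x*z] = solve 3 (λ x y z → x :* (y :* z) := y :* (x :* z)) refl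

module RealAnalysis {c ℓ₁ ℓ₂} (ℝ : RealNumbers c ℓ₁ ℓ₂) where

  open Analysis ℝ hiding (zero)

  private
    module ℂᵣ = ℂ-Ring

  open IntegerCoefficients commutativeRing public
    using (solve; _:=_; _:+_; _:*_; _:-_; :-_; _:^_; con; :1)
  open Exp (CommutativeRing.commutativeSemiring commutativeRing) public
    using (_^_; ^-distrib-*)
  open Mult (CommutativeRing.semiring commutativeRing) using (×1-homo-*)
  open IsStrictPartialOrder isStrictPartialOrder public
    using (<-resp-≈; <-respʳ-≈; <-respˡ-≈)
    renaming (irrefl to <-irrefl; trans to <-trans; asym to <-asym)


  -- Order

  -- The constructive substitute for trichotomy. Where the apartness points the wrong way,
  -- transitivity with x < y yields the other alternative.
  <-cotrans : ∀ {x y} → x < y → ∀ z → x < z ⊎ z < y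
  <-cotrans {x} {y} x<y z with #-cotrans (Equivalence.from #⇔<⊎> (inj₁ x<y)) z
  ... | inj₁ x#z with Equivalence.to #⇔<⊎> x#z
  ...   | inj₁ x<z = inj₁ x<z
  ...   | inj₂ z<x = inj₂ (<-trans z<x x<y)
  <-cotrans {x} {y} x<y z | inj₂ z#y with Equivalence.to #⇔<⊎> z#y
  ...   | inj₁ z<y = inj₂ z<y
  ...   | inj₂ y<z = inj₁ (<-trans x<y y<z)

  <⇒≤ : ∀ {x y} → x < y → x ≤ y
  <⇒≤ = <-asym

  ≤-reflexive : ∀ {x y} → x ≈ y → x ≤ y
  ≤-reflexive x≈y = <-irrefl (sym x≈y)

  ≤-refl : ∀ {x} → x ≤ x
  ≤-refl = ≤-reflexive refl

  ≤-trans : ∀ {x y z} → x ≤ y → y ≤ z → x ≤ z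
  ≤-trans {y = y} x≤y y≤z z<x = [ y≤z , x≤y ]′ (<-cotrans z<x y)

  <-≤-trans : ∀ {x y z} → x < y → y ≤ z → x < z
  <-≤-trans x<y y≤z = [ (λ x<z → x<z) , (λ z<y → ⊥-elim (y≤z z<y)) ]′ (<-cotrans x<y _)

  ≤-<-trans : ∀ {x y z} → x ≤ y → y < z → x < z
  ≤-<-trans x≤y y<z = [ (λ y<x → ⊥-elim (x≤y y<x)) , (λ x<z → x<z) ]′ (<-cotrans y<z _)

  ≤-antisym : ∀ {x y} → x ≤ y → y ≤ x → x ≈ y
  ≤-antisym x≤y y≤x = proj₁ (tight _ _)
    (λ x#y → [ y≤x , x≤y ]′ (Equivalence.to #⇔<⊎> x#y))

  ≤-isPreorder : IsPreorder _≈_ _≤_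
  ≤-isPreorder = record
    { isEquivalence = isEquivalence ; reflexive = ≤-reflexive ; trans = ≤-trans }

  module ≤-Reasoning = Triple ≤-isPreorder <-asym <-trans <-resp-≈ <⇒≤ <-≤-trans ≤-<-trans

  -- Non-strict inequalities are negative statements, so they may be proved classically.
  ≤-by-cases : ∀ {u v x y} → (u < v → x ≤ y) → (v ≤ u → x ≤ y) → x ≤ y
  ≤-by-cases lt ge y<x = ge (λ u<v → lt u<v y<x) y<x

  -- Inequalities are usually proved by certifying the difference of the two
  -- sides as a combination of non-negative quantities.

  <-by-difference : ∀ {x y p} → 0# < p → y - x ≈ p → x < y
  <-by-difference {x} {y} {p} 0<p eq = <-respˡ-≈ (+-identityˡ x)
    (<-respʳ-≈ (trans (+-congʳ (sym eq)) (solve 2 (λ x y → y :- x :+ x := y) refl x y))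
      (+-monoˡ-< x 0<p))

  x<y⇒0<y-x : ∀ {x y} → x < y → 0# < y - x
  x<y⇒0<y-x {x} x<y = <-respˡ-≈ (-‿inverseʳ x) (+-monoˡ-< (- x) x<y)

  ≤-by-difference : ∀ {x y p} → 0# ≤ p → y - x ≈ p → x ≤ y
  ≤-by-difference {x} {y} 0≤p eq y<x = 0≤p
    (<-respˡ-≈ eq (<-respʳ-≈ (-‿inverseʳ x) (+-monoˡ-< (- x) y<x)))

  x≤y⇒0≤y-x : ∀ {x y} → x ≤ y → 0# ≤ y - x
  x≤y⇒0≤y-x {x} {y} x≤y y-x<0 = x≤y (<-respˡ-≈ (solve 2 (λ x y → y :- x :+ x := y) refl x y)
    (<-respʳ-≈ (+-identityˡ x) (+-monoˡ-< x y-x<0)))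

  +-mono-< : ∀ {x y u v} → x < y → u < v → x + u < y + v
  +-mono-< {y = y} {u} x<y u<v = <-trans (+-monoˡ-< u x<y)
    (<-respˡ-≈ (+-comm u y) (<-respʳ-≈ (+-comm _ y) (+-monoˡ-< y u<v)))

  +-monoˡ-≤ : ∀ z {x y} → x ≤ y → x + z ≤ y + z
  +-monoˡ-≤ z {x} {y} x≤y = ≤-by-difference (x≤y⇒0≤y-x x≤y)
    (solve 3 (λ x y z → (y :+ z) :- (x :+ z) := y :- x) refl x y z)

  +-monoʳ-≤ : ∀ z {x y} → x ≤ y → z + x ≤ z + y
  +-monoʳ-≤ z {x} {y} x≤y = ≤-by-difference (x≤y⇒0≤y-x x≤y)
    (solve 3 (λ x y z → (z :+ y) :- (z :+ x) := y :- x) refl x y z)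

  +-mono-≤ : ∀ {x y u v} → x ≤ y → u ≤ v → x + u ≤ y + v
  +-mono-≤ x≤y u≤v = ≤-trans (+-monoˡ-≤ _ x≤y) (+-monoʳ-≤ _ u≤v)

  0≤x+y : ∀ {x y} → 0# ≤ x → 0# ≤ y → 0# ≤ x + y
  0≤x+y 0≤x 0≤y = ≤-trans (≤-reflexive (sym (+-identityˡ 0#))) (+-mono-≤ 0≤x 0≤y)

  0<x+y : ∀ {x y} → 0# < x → 0# ≤ y → 0# < x + y
  0<x+y {x} 0<x 0≤y = <-≤-trans 0<x
    (≤-trans (≤-reflexive (sym (+-identityʳ x))) (+-monoʳ-≤ x 0≤y))

  0≤x*y : ∀ {x y} → 0# ≤ x → 0# ≤ y → 0# ≤ x * y
  0≤x*y {x} {y} 0≤x 0≤y = ≤-by-cases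
    (λ 0<x → ≤-by-cases
      (λ 0<y → <⇒≤ (*-positive 0<x 0<y))
      (λ y≤0 → ≤-reflexive (sym (trans (*-congˡ (≤-antisym y≤0 0≤y)) (zeroʳ x)))))
    (λ x≤0 → ≤-reflexive (sym (trans (*-congʳ (≤-antisym x≤0 0≤x)) (zeroˡ y))))

  neg-mono-≤ : ∀ {x y} → x ≤ y → - y ≤ - x
  neg-mono-≤ {x} {y} x≤y = ≤-by-difference (x≤y⇒0≤y-x x≤y)
    (solve 2 (λ x y → (:- x) :- (:- y) := y :- x) refl x y)

  *-monoʳ-< : ∀ {z x y} → 0# < z → x < y → z * x < z * y
  *-monoʳ-< {z} {x} {y} 0<z x<y = <-by-difference (*-positive 0<z (x<y⇒0<y-x x<y))
    (solve 3 (λ x y z → z :* y :- z :* x := z :* (y :- x)) refl x y z)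

  *-monoʳ-≤ : ∀ {z x y} → 0# ≤ z → x ≤ y → z * x ≤ z * y
  *-monoʳ-≤ {z} {x} {y} 0≤z x≤y = ≤-by-difference (0≤x*y 0≤z (x≤y⇒0≤y-x x≤y))
    (solve 3 (λ x y z → z :* y :- z :* x := z :* (y :- x)) refl x y z)

  *-monoˡ-≤ : ∀ {z x y} → 0# ≤ z → x ≤ y → x * z ≤ y * z
  *-monoˡ-≤ {z} {x} {y} 0≤z x≤y = ≤-by-difference (0≤x*y 0≤z (x≤y⇒0≤y-x x≤y))
    (solve 3 (λ x y z → y :* z :- x :* z := z :* (y :- x)) refl x y z)

  *-mono-≤ : ∀ {x y u v} → 0# ≤ x → 0# ≤ v → x ≤ y → u ≤ v → x * u ≤ y * v
  *-mono-≤ 0≤x 0≤v x≤y u≤v = ≤-trans (*-monoʳ-≤ 0≤x u≤v) (*-monoˡ-≤ 0≤v x≤y)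

  *-cancelˡ-≤ : ∀ {z x y} → 0# < z → z * x ≤ z * y → x ≤ y
  *-cancelˡ-≤ 0<z zx≤zy y<x = zx≤zy (*-monoʳ-< 0<z y<x)

  *-cancelˡ-≈ : ∀ {z x y} → 0# < z → z * x ≈ z * y → x ≈ y
  *-cancelˡ-≈ 0<z eq = ≤-antisym
    (*-cancelˡ-≤ 0<z (≤-reflexive eq)) (*-cancelˡ-≤ 0<z (≤-reflexive (sym eq)))

  0≤x² : ∀ x → 0# ≤ x * x
  0≤x² x = ≤-by-cases
    (λ 0<x → <⇒≤ (*-positive 0<x 0<x))
    (λ x≤0 → let 0≤-x = 0≤-x′ x≤0 in
      ≤-by-difference (0≤x*y 0≤-x 0≤-x) (solve 1 (λ x → x :* x :- con 0ℤ := (:- x) :* (:- x)) refl x))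
    where
    0≤-x′ : x ≤ 0# → 0# ≤ - x
    0≤-x′ x≤0 = ≤-by-difference (x≤y⇒0≤y-x x≤0)
      (solve 1 (λ x → :- x :- con 0ℤ := con 0ℤ :- x) refl x)

  0≤-half : ∀ {x} → 0# ≤ x + x → 0# ≤ x
  0≤-half 0≤2x x<0 = 0≤2x (<-respʳ-≈ (+-identityˡ 0#) (+-mono-< x<0 x<0))

  -- x inverts its reciprocal, so the reciprocal is apart from 0; if it were negative, the product 1
  -- would be negative too.
  recip-positive : ∀ x (0<x : 0# < x) → 0# < recip x 0<x
  recip-positive x 0<x with Equivalence.to #⇔<⊎> (invertible⇒# {y} {0#} (x , left , right))
    where
    y = recip x 0<x
    left : x * (y - 0#) ≈ 1#
    left = trans (solve 2 (λ x y → x :* (y :- con 0ℤ) := x :* y) refl x y) (recip-inverseʳ x 0<x)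
    right : (y - 0#) * x ≈ 1#
    right = trans (*-comm _ _) left
  ... | inj₂ 0<y = 0<y
  ... | inj₁ y<0 = ⊥-elim (<-asym 0<1
    (<-respˡ-≈ (recip-inverseʳ x 0<x) (<-respʳ-≈ (zeroʳ x) (*-monoʳ-< 0<x y<0))))

  fromℕ-* : ∀ m n → fromℕ (m ℕ.* n) ≈ fromℕ m * fromℕ n
  fromℕ-* = ×1-homo-*

  0≤fromℕ : ∀ n → 0# ≤ fromℕ n
  0≤fromℕ ℕ.zero = ≤-refl
  0≤fromℕ (suc n) = <⇒≤ (fromℕ-positive (suc n))

  fromℕ-mono-≤ : ∀ {m n} → m ℕ.≤ n → fromℕ m ≤ fromℕ n
  fromℕ-mono-≤ {n = n} ℕ.z≤n = 0≤fromℕ n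
  fromℕ-mono-≤ (ℕ.s≤s m≤n) = +-monoʳ-≤ 1# (fromℕ-mono-≤ m≤n)

  0≤1 : 0# ≤ 1#
  0≤1 = <⇒≤ 0<1

  1≤fromℕ : ∀ n → .{{ℕ.NonZero n}} → 1# ≤ fromℕ n
  1≤fromℕ (suc n) = ≤-trans (≤-reflexive (sym (+-identityʳ 1#))) (fromℕ-mono-≤ (ℕ.s≤s (ℕ.z≤n {n})))

  0≤x^n : ∀ {x} n → 0# ≤ x → 0# ≤ x ^ n
  0≤x^n ℕ.zero 0≤x = 0≤1
  0≤x^n (suc n) 0≤x = 0≤x*y 0≤x (0≤x^n n 0≤x)

  0<x^n : ∀ {x} n → 0# < x → 0# < x ^ n
  0<x^n ℕ.zero 0<x = 0<1
  0<x^n (suc n) 0<x = *-positive 0<x (0<x^n n 0<x)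

  1≤x*y : ∀ {x y} → 1# ≤ x → 1# ≤ y → 1# ≤ x * y
  1≤x*y 1≤x 1≤y = ≤-trans (≤-reflexive (sym (*-identityˡ 1#)))
    (*-mono-≤ 0≤1 (≤-trans 0≤1 1≤y) 1≤x 1≤y)

  1≤x^n : ∀ {x} n → 1# ≤ x → 1# ≤ x ^ n
  1≤x^n ℕ.zero 1≤x = ≤-refl
  1≤x^n (suc n) 1≤x = 1≤x*y 1≤x (1≤x^n n 1≤x)

  ^-mono-≤ : ∀ {x y} n → 0# ≤ x → x ≤ y → x ^ n ≤ y ^ n
  ^-mono-≤ ℕ.zero 0≤x x≤y = ≤-refl
  ^-mono-≤ (suc n) 0≤x x≤y = *-mono-≤ 0≤x (0≤x^n n (≤-trans 0≤x x≤y)) x≤y (^-mono-≤ n 0≤x x≤y)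

  -- Two-sided bounds in place of absolute values.

  infix 4 ∣_∣≤_

  ∣_∣≤_ : Carrier → Carrier → Set ℓ₂
  ∣ x ∣≤ a = (- a ≤ x) × (x ≤ a)

  ∣∣≤-cong : ∀ {x y a b} → x ≈ y → a ≈ b → ∣ x ∣≤ a → ∣ y ∣≤ b
  ∣∣≤-cong x≈y a≈b (-a≤x , x≤a) =
      ≤-trans (≤-reflexive (-‿cong (sym a≈b))) (≤-trans -a≤x (≤-reflexive x≈y))
    , ≤-trans (≤-reflexive (sym x≈y)) (≤-trans x≤a (≤-reflexive a≈b))

  ∣∣≤-weaken : ∀ {x a b} → a ≤ b → ∣ x ∣≤ a → ∣ x ∣≤ b
  ∣∣≤-weaken a≤b (-a≤x , x≤a) = ≤-trans (neg-mono-≤ a≤b) -a≤x , ≤-trans x≤a a≤b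

  ∣x∣≤x : ∀ {x} → 0# ≤ x → ∣ x ∣≤ x
  ∣x∣≤x {x} 0≤x = ≤-by-difference (0≤x+y 0≤x 0≤x) (solve 1 (λ x → x :- (:- x) := x :+ x) refl x) , ≤-refl

  ∣∣≤-neg : ∀ {x a} → ∣ x ∣≤ a → ∣ - x ∣≤ a
  ∣∣≤-neg {x} {a} (-a≤x , x≤a) = neg-mono-≤ x≤a ,
    ≤-by-difference (x≤y⇒0≤y-x -a≤x) (solve 2 (λ x a → a :- (:- x) := x :- (:- a)) refl x a)

  ∣∣≤-+ : ∀ {x y a b} → ∣ x ∣≤ a → ∣ y ∣≤ b → ∣ x + y ∣≤ a + b
  ∣∣≤-+ {a = a} {b} (-a≤x , x≤a) (-b≤y , y≤b) =
    ≤-trans (≤-reflexive (solve 2 (λ a b → :- (a :+ b) := (:- a) :+ (:- b)) refl a b)) (+-mono-≤ -a≤x -b≤y) ,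
    +-mono-≤ x≤a y≤b

  -- Twice a b + x y, and likewise twice a b - x y, is a sum of two products of the non-negative
  -- numbers a + x, a - x, b + y and b - y.
  ∣∣≤-* : ∀ {x y a b} → ∣ x ∣≤ a → ∣ y ∣≤ b → ∣ x * y ∣≤ a * b
  ∣∣≤-* {x} {y} {a} {b} (-a≤x , x≤a) (-b≤y , y≤b) =
    ≤-by-difference (0≤-half (≤-trans (0≤x+y (0≤x*y p r) (0≤x*y q s)) (≤-reflexive
      (solve 4 (λ x y a b → (x :- (:- a)) :* (y :- (:- b)) :+ (a :- x) :* (b :- y)
                         := (x :* y :- (:- (a :* b))) :+ (x :* y :- (:- (a :* b)))) refl x y a b)))) refl ,
    ≤-by-difference (0≤-half (≤-trans (0≤x+y (0≤x*y p s) (0≤x*y q r)) (≤-reflexive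
      (solve 4 (λ x y a b → (x :- (:- a)) :* (b :- y) :+ (a :- x) :* (y :- (:- b))
                         := (a :* b :- x :* y) :+ (a :* b :- x :* y)) refl x y a b)))) refl
    where
    p = x≤y⇒0≤y-x -a≤x
    q = x≤y⇒0≤y-x x≤a
    r = x≤y⇒0≤y-x -b≤y
    s = x≤y⇒0≤y-x y≤b

  ∣∣≤⇒²≤ : ∀ {x a} → ∣ x ∣≤ a → x * x ≤ a * a
  ∣∣≤⇒²≤ p = proj₂ (∣∣≤-* p p)

  *-cancelˡ-< : ∀ {z x y} → 0# < z → z * x < z * y → x < y
  *-cancelˡ-< {z} {x} {y} 0<z zx<zy =
    <-respˡ-≈ (undo x) (<-respʳ-≈ (undo y) (*-monoʳ-< (recip-positive z 0<z) zx<zy))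
    where
    undo : ∀ x → recip z 0<z * (z * x) ≈ x
    undo x = trans
      (solve 3 (λ x z w → w :* (z :* x) := (z :* w) :* x) refl x z (recip z 0<z))
      (trans (*-congʳ (recip-inverseʳ z 0<z)) (*-identityˡ x))

  half : Carrier
  half = recip (fromℕ 2) (fromℕ-positive 2)

  half-positive : 0# < half
  half-positive = recip-positive (fromℕ 2) (fromℕ-positive 2)

  halves : ∀ x → half * x + half * x ≈ x
  halves x = trans
    (solve 2 (λ x h → h :* x :+ h :* x := (con (+ 2) :* h) :* x) refl x half)
    (trans (*-congʳ (recip-inverseʳ (fromℕ 2) (fromℕ-positive 2))) (*-identityˡ x))

  archimedean-inverse : ∀ {ε} → 0# < ε → ∃[ N ] 1# < fromℕ N * ε
  archimedean-inverse {ε} 0<ε = let N , 1/ε<N = archimedean (recip ε 0<ε) in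
    N , <-respˡ-≈ (recip-inverseʳ ε 0<ε)
    (<-respʳ-≈ (*-comm ε (fromℕ N)) (*-monoʳ-< 0<ε 1/ε<N))

  -- Limits

  -- One-sided, because these sequences only serve as upper bounds for errors.
  IsNull : (ℕ → Carrier) → Set _
  IsNull e = ∀ ε → 0# < ε → ∃[ N ] ∀ n → N ℕ.≤ n → e n < ε

  null-* : ∀ {e k} → 0# < k → IsNull e → IsNull (λ n → k * e n)
  null-* {e} {k} 0<k null ε 0<ε =
    let N , e<ε/k = null (recip k 0<k * ε) (*-positive (recip-positive k 0<k) 0<ε) in
    N , λ n N≤n → <-respʳ-≈
    (trans (sym (*-assoc k _ ε)) (trans (*-congʳ (recip-inverseʳ k 0<k)) (*-identityˡ ε)))
    (*-monoʳ-< 0<k (e<ε/k n N≤n))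

  ≤-null⇒≤0 : ∀ {x e} → IsNull e → (K : ℕ) → (∀ n → K ℕ.≤ n → x ≤ e n) → x ≤ 0#
  ≤-null⇒≤0 {x} null K x≤e 0<x = let N , e<x = null x 0<x in
    x≤e (K ℕ.+ N) (ℕ.m≤m+n K N) (e<x (K ℕ.+ N) (ℕ.m≤n+m N K))

  -- A Bernoulli inequality free of division: the left side decreases with n, by t^n (n + 1) (1 -
  -- t)² at each step.
  bernoulli : ∀ {t} → 0# ≤ t → t ≤ 1# → ∀ n → t ^ n * (1# + fromℕ n * (1# - t)) ≤ 1#
  bernoulli {t} 0≤t t≤1 ℕ.zero = ≤-reflexive
    (solve 1 (λ t → :1 :* (:1 :+ con 0ℤ :* (:1 :- t)) := :1) refl t)
  bernoulli {t} 0≤t t≤1 (suc n) = ≤-trans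
    (≤-by-difference
      (0≤x*y (0≤x^n n 0≤t) (0≤x*y (0≤fromℕ (suc n)) (0≤x² (1# - t))))
      (solve 3 (λ t p n → p :* (:1 :+ n :* (:1 :- t)) :- (t :* p) :* (:1 :+ (:1 :+ n) :* (:1 :- t))
                        := p :* ((:1 :+ n) :* ((:1 :- t) :* (:1 :- t))))
        refl t (t ^ n) (fromℕ n)))
    (bernoulli 0≤t t≤1 n)

  geometric-null : ∀ {t} → 0# ≤ t → t < 1# → IsNull (t ^_)
  geometric-null {t} 0≤t t<1 ε 0<ε =
    let N , 1<Nsε = archimedean-inverse (*-positive (x<y⇒0<y-x t<1) 0<ε) in
    N , λ n N≤n → *-cancelˡ-< (0<1+ns n) (begin-strict
    (1# + fromℕ n * s) * t ^ n  ≈⟨ *-comm _ _ ⟩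
    t ^ n * (1# + fromℕ n * s)  ≤⟨ bernoulli 0≤t (<⇒≤ t<1) n ⟩
    1#                          <⟨ 1<Nsε ⟩
    fromℕ N * (s * ε)           ≤⟨ *-monoˡ-≤ (<⇒≤ (*-positive 0<s 0<ε)) (fromℕ-mono-≤ N≤n) ⟩
    fromℕ n * (s * ε)           ≤⟨ ≤-by-difference (<⇒≤ 0<ε)
      (solve 3 (λ n s ε → (:1 :+ n :* s) :* ε :- n :* (s :* ε) := ε) refl (fromℕ n) s ε) ⟩
    (1# + fromℕ n * s) * ε      ∎)
    where
    open ≤-Reasoning
    s = 1# - t
    0<s = x<y⇒0<y-x t<1
    0<1+ns : ∀ n → 0# < 1# + fromℕ n * s
    0<1+ns n = 0<x+y 0<1 (0≤x*y (0≤fromℕ n) (<⇒≤ 0<s))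

  -- Telescoping: increments dominated by the decrements of e.
  module Envelope (u e : ℕ → Carrier) (K : ℕ) (0≤e : ∀ n → 0# ≤ e n)
    (step : ∀ n → K ℕ.≤ n → ∣ u (suc n) - u n ∣≤ e n - e (suc n)) where

    private
      telescope : ∀ {n m} → K ℕ.≤ n → n ℕ.≤′ m → ∣ u m - u n ∣≤ e n - e m
      telescope {n} K≤n (ℕ.≤′-reflexive ≡.refl) = ∣∣≤-cong
        (sym (-‿inverseʳ (u n))) (sym (-‿inverseʳ (e n))) (∣x∣≤x ≤-refl)
      telescope {n} K≤n (ℕ.≤′-step {m} n≤m) = ∣∣≤-cong
        (solve 3 (λ x y z → (z :- y) :+ (y :- x) := z :- x) refl (u n) (u m) (u (suc m)))
        (solve 3 (λ x y z → (y :- z) :+ (x :- y) := x :- z) refl (e n) (e m) (e (suc m)))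
        (∣∣≤-+ (step m (ℕ.≤-trans K≤n (ℕ.≤′⇒≤ n≤m))) (telescope K≤n n≤m))

    difference : ∀ {n m} → K ℕ.≤ n → n ℕ.≤ m → ∣ u m - u n ∣≤ e n
    difference {n} {m} K≤n n≤m = ∣∣≤-weaken
      (≤-by-difference (0≤e m) (solve 2 (λ x y → x :- (x :- y) := y) refl (e n) (e m)))
      (telescope K≤n (ℕ.≤⇒≤′ n≤m))

    cauchy : IsNull e → IsCauchy u
    cauchy null ε 0<ε =
      let N , e<ε/2 = null (half * ε) (*-positive half-positive 0<ε)
          M = K ℕ.+ N
          e<δ = e<ε/2 M (ℕ.m≤n+m N K)
          bound : ∀ m → M ℕ.≤ m → ∣ u m - u M ∣≤ e M
          bound m = difference (ℕ.m≤m+n K N)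
      in M , λ m n M≤m M≤n → <-by-difference
        (x<y⇒0<y-x (≤-<-trans (proj₂ (∣∣≤-+ (bound m M≤m) (∣∣≤-neg (bound n M≤n))))
          (<-respʳ-≈ (halves ε) (+-mono-< e<δ e<δ))))
        (solve 4 (λ x y z ε → (y :+ ε) :- x := ε :- ((x :- z) :+ (:- (y :- z)))) refl
          (u m) (u n) (u M) ε)

  limit-≤ : ∀ {u x a} → u ⟶ x → (K : ℕ) → (∀ n → K ℕ.≤ n → u n ≤ a) → x ≤ a
  limit-≤ {u} {x} {a} u⟶x K u≤a a<x =
    let N , close = u⟶x (x - a) (x<y⇒0<y-x a<x)
        n = K ℕ.+ N
    in u≤a n (ℕ.m≤m+n K N) (<-by-difference
    (x<y⇒0<y-x (proj₂ (close n (ℕ.m≤n+m N K))))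
    (solve 3 (λ u x a → u :- a := (u :+ (x :- a)) :- x) refl (u n) x a))
  limit-≥ : ∀ {u x a} → u ⟶ x → (K : ℕ) → (∀ n → K ℕ.≤ n → a ≤ u n) → a ≤ x
  limit-≥ {u} {x} {a} u⟶x K a≤u x<a =
    let N , close = u⟶x (a - x) (x<y⇒0<y-x x<a)
        n = K ℕ.+ N
    in a≤u n (ℕ.m≤m+n K N) (<-by-difference
    (x<y⇒0<y-x (proj₁ (close n (ℕ.m≤n+m N K))))
    (solve 3 (λ u x a → a :- u := (x :+ (a :- x)) :- u) refl (u n) x a))
  ⟶-cong : ∀ {u v x} → (∀ n → u n ≈ v n) → u ⟶ x → v ⟶ x
  ⟶-cong u≈v u⟶x ε 0<ε = let N , close = u⟶x ε 0<ε in
    N , λ n N≤n →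
    <-respˡ-≈ (u≈v n) (proj₁ (close n N≤n)) , <-respʳ-≈ (+-congʳ (u≈v n)) (proj₂ (close n N≤n))

  limit-∣∣≤ : ∀ {u x y a} → u ⟶ x → (K : ℕ) → (∀ n → K ℕ.≤ n → ∣ u n - y ∣≤ a) → ∣ x - y ∣≤ a
  limit-∣∣≤ {u} {x} {y} {a} u⟶x K near =
    ≤-by-difference (x≤y⇒0≤y-x (limit-≥ u⟶x K (λ n K≤n → ≤-by-difference
        (x≤y⇒0≤y-x (proj₁ (near n K≤n)))
        (solve 3 (λ u y a → u :- (y :- a) := (u :- y) :- (:- a)) refl (u n) y a))))
      (solve 3 (λ x y a → (x :- y) :- (:- a) := x :- (y :- a)) refl x y a) ,
    ≤-by-difference (x≤y⇒0≤y-x (limit-≤ u⟶x K (λ n K≤n → ≤-by-difference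
        (x≤y⇒0≤y-x (proj₂ (near n K≤n)))
        (solve 3 (λ u y a → (y :+ a) :- u := a :- (u :- y)) refl (u n) y a))))
      (solve 3 (λ x y a → a :- (x :- y) := (y :+ a) :- x) refl x y a)

  -- For 0 ≤ t < 1 the iteration y ↦ (t + y²) / 2 contracts on [0, t] to 1 - √(1 - t).
  module SquareRootIteration {t} (0≤t : 0# ≤ t) (t<1 : t < 1#) where

    y : ℕ → Carrier
    y ℕ.zero = 0#
    y (suc n) = half * (t + y n * y n)

    private
      t≤1 = <⇒≤ t<1
      0≤half = <⇒≤ half-positive
      1/s = recip (1# - t) (x<y⇒0<y-x t<1)

      -- The tail of the geometric series, whose decrements are exactly the powers t^n that bound
      -- the increments of y.
      e : ℕ → Carrier
      e n = 1/s * t ^ n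

      0≤y : ∀ n → 0# ≤ y n
      0≤y ℕ.zero = ≤-refl
      0≤y (suc n) = 0≤x*y 0≤half (0≤x+y 0≤t (0≤x² (y n)))

      y≤t : ∀ n → y n ≤ t
      y≤t ℕ.zero = 0≤t
      y≤t (suc n) = ≤-trans
        (*-monoʳ-≤ 0≤half (+-monoʳ-≤ t
          (≤-trans (*-mono-≤ (0≤y n) 0≤1 (y≤t n) (≤-trans (y≤t n) t≤1)) (≤-reflexive (*-identityʳ t)))))
        (≤-reflexive (trans (distribˡ half t t) (halves t)))

      ∣y∣≤t : ∀ n → ∣ y n ∣≤ t
      ∣y∣≤t n = ∣∣≤-weaken (y≤t n) (∣x∣≤x (0≤y n))

      -- Two successive increments differ by the factor half (y' + y) ≤ t, since half (x² - y²) =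
      -- half (x + y) (x - y).
      increment : ∀ n → ∣ y (suc n) - y n ∣≤ t ^ n
      increment ℕ.zero = ∣∣≤-weaken half*t≤1 (∣∣≤-cong
        (solve 2 (λ h t → h :* t := h :* (t :+ con 0ℤ :* con 0ℤ) :- con 0ℤ) refl half t)
        refl (∣x∣≤x (0≤x*y 0≤half 0≤t)))
        where
        half*t≤1 : half * t ≤ 1#
        half*t≤1 = ≤-trans (≤-by-difference (0≤x*y 0≤half 0≤t)
          (trans (+-congʳ (sym (halves t))) (solve 2 (λ h t → (h :* t :+ h :* t) :- h :* t := h :* t) refl half t))) t≤1
      increment (suc n) = ∣∣≤-cong
        (solve 4 (λ h x y t → h :* ((x :+ y) :* (x :- y)) := h :* (t :+ x :* x) :- h :* (t :+ y :* y))
          refl half (y (suc n)) (y n) t)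
        (trans (solve 3 (λ h t p → h :* ((t :+ t) :* p) := (h :* t :+ h :* t) :* p) refl half t (t ^ n))
          (*-congʳ (halves t)))
        (∣∣≤-* (∣x∣≤x 0≤half) (∣∣≤-* (∣∣≤-+ (∣y∣≤t (suc n)) (∣y∣≤t n)) (increment n)))

      decrement : ∀ n → t ^ n ≈ e n - e (suc n)
      decrement n = sym (trans
        (solve 3 (λ i t p → i :* p :- i :* (t :* p) := ((:1 :- t) :* i) :* p) refl 1/s t (t ^ n))
        (trans (*-congʳ (recip-inverseʳ (1# - t) _)) (*-identityˡ (t ^ n))))

      0<1/s = recip-positive (1# - t) (x<y⇒0<y-x t<1)

      module E = Envelope y e 0 (λ n → 0≤x*y (<⇒≤ 0<1/s) (0≤x^n n 0≤t))
        (λ n _ → ∣∣≤-cong refl (decrement n) (increment n))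

      e-null : IsNull e
      e-null = null-* 0<1/s (geometric-null 0≤t t<1)

      limit = complete y (E.cauchy e-null)

    y∞ : Carrier
    y∞ = proj₁ limit

    y∞≤t : y∞ ≤ t
    y∞≤t = limit-≤ (proj₂ limit) 0 (λ n _ → y≤t n)

    private
      0≤y∞ : 0# ≤ y∞
      0≤y∞ = limit-≥ (proj₂ limit) 0 (λ n _ → 0≤y n)

      ∣y∞∣≤1 : ∣ y∞ ∣≤ 1#
      ∣y∞∣≤1 = ∣∣≤-weaken (≤-trans y∞≤t t≤1) (∣x∣≤x 0≤y∞)

      close : ∀ n → ∣ y∞ - y n ∣≤ e n
      close n = limit-∣∣≤ (proj₂ limit) n (λ m n≤m → E.difference ℕ.z≤n n≤m)

      e-antitone : ∀ n → e (suc n) ≤ e n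
      e-antitone n = ≤-by-difference (0≤x^n n 0≤t) (sym (decrement n))

      -- As 2 y_{n+1} = t + y_n², the defect is (y∞ + y_n) (y∞ - y_n) - 2 (y∞ - y_{n+1}), where y∞
      -- and y_n are at most 1 and both differences are within `e n`.
      defect : ∀ n → ∣ (t + y∞ * y∞) - (y∞ + y∞) ∣≤ fromℕ 4 * e n
      defect n = ∣∣≤-cong
        (trans (solve 4 (λ a b c t → (a :+ b) :* (a :- b) :- ((a :- c) :+ (a :- c))
              := ((t :+ a :* a) :- (a :+ a)) :+ ((c :+ c) :- (t :+ b :* b)))
              refl y∞ (y n) (y (suc n)) t)
            (trans (+-congˡ (trans (+-congʳ (halves (t + y n * y n))) (-‿inverseʳ _))) (+-identityʳ _)))
        (solve 1 (λ e → (:1 :+ :1) :* e :+ (e :+ e) := con (+ 4) :* e) refl (e n))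
        (∣∣≤-+ (∣∣≤-* (∣∣≤-+ ∣y∞∣≤1 (∣∣≤-weaken t≤1 (∣y∣≤t n))) (close n))
               (∣∣≤-neg (∣∣≤-+ close′ close′)))
        where
        close′ : ∣ y∞ - y (suc n) ∣≤ e n
        close′ = ∣∣≤-weaken (e-antitone n) (close (suc n))

    fixed-point : t + y∞ * y∞ ≈ y∞ + y∞
    fixed-point = trans
      (sym (solve 2 (λ a b → (a :- b) :+ b := a) refl (t + y∞ * y∞) (y∞ + y∞)))
      (trans (+-congʳ (≤-antisym
        (≤-null⇒≤0 null 0 (λ n _ → proj₂ (defect n)))
        (≤-by-difference (x≤y⇒0≤y-x (≤-null⇒≤0 null 0 (λ n _ → proj₂ (∣∣≤-neg (defect n)))))
          (solve 1 (λ x → x :- con 0ℤ := con 0ℤ :- (:- x)) refl _))))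
        (+-identityˡ _))
      where
      null = null-* (fromℕ-positive 4) e-null

  -- A natural number M > 1 + x has M² > x, so t = 1 - x / M² lies in [0, 1). The fixed point gives
  -- (1 - y∞)² = 1 - t = x / M², and M (1 - y∞) is the root.
  square-root : ∀ {x} → 0# < x → ∃[ r ] (0# ≤ r) × (r * r ≈ x)
  square-root {x} 0<x = M * (1# - y∞)
    , 0≤x*y (<⇒≤ 0<M) (x≤y⇒0≤y-x (≤-trans y∞≤t (<⇒≤ t<1)))
    , (begin-equality
        (M * (1# - y∞)) * (M * (1# - y∞))        ≈⟨ solve 2 (λ m y → (m :* (:1 :- y)) :* (m :* (:1 :- y))
                                                     := (m :* m) :* ((:1 :+ y :* y) :- (y :+ y))) refl M y∞ ⟩
        M * M * ((1# + y∞ * y∞) - (y∞ + y∞))     ≈⟨ *-congˡ (+-congˡ (-‿cong fixed-point)) ⟨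
        M * M * ((1# + y∞ * y∞) - (t + y∞ * y∞)) ≈⟨ solve 4 (λ m y x i → (m :* m) :* ((:1 :+ y :* y) :- ((:1 :- x :* i) :+ y :* y))
                                                     := x :* ((m :* m) :* i)) refl M y∞ x i ⟩
        x * (M * M * i)                          ≈⟨ *-congˡ (recip-inverseʳ (M * M) 0<M²) ⟩
        x * 1#                                   ≈⟨ *-identityʳ x ⟩
        x                                        ∎)
    where
    open ≤-Reasoning
    M = fromℕ (proj₁ (archimedean (1# + x)))
    1+x<m = proj₂ (archimedean (1# + x))
    1<M : 1# < M
    1<M = <-trans (<-by-difference 0<x (solve 1 (λ x → (:1 :+ x) :- :1 := x) refl x)) 1+x<m
    0<M = <-trans 0<1 1<M
    0<M² = *-positive 0<M 0<M
    i = recip (M * M) 0<M²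
    0<i = recip-positive (M * M) 0<M²
    t = 1# - x * i

    x<M² : x < M * M
    x<M² = begin-strict
      x        <⟨ <-by-difference 0<1 (solve 1 (λ x → (:1 :+ x) :- x := :1) refl x) ⟩
      1# + x   <⟨ 1+x<m ⟩
      M        ≈⟨ *-identityʳ M ⟨
      M * 1#   <⟨ *-monoʳ-< 0<M 1<M ⟩
      M * M    ∎

    t<1 : t < 1#
    t<1 = <-by-difference (*-positive 0<x 0<i) (solve 2 (λ x i → :1 :- (:1 :- x :* i) := x :* i) refl x i)

    0≤t : 0# ≤ t
    0≤t = x≤y⇒0≤y-x (begin
      x * i        ≈⟨ *-comm x i ⟩
      i * x        <⟨ *-monoʳ-< 0<i x<M² ⟩
      i * (M * M)  ≈⟨ *-comm _ _ ⟩
      M * M * i    ≈⟨ recip-inverseʳ (M * M) 0<M² ⟩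
      1#           ∎)

    open SquareRootIteration 0≤t t<1

  *-limit : ∀ {u x k} → 0# < k → u ⟶ x → (λ n → k * u n) ⟶ k * x
  *-limit {u} {x} {k} 0<k u⟶x ε 0<ε =
    let N , close = u⟶x (recip k 0<k * ε) (*-positive (recip-positive k 0<k) 0<ε) in
    N , λ n N≤n → scale (proj₁ (close n N≤n)) , scale (proj₂ (close n N≤n))
    where
    scale : ∀ {x y} → x < y + recip k 0<k * ε → k * x < k * y + ε
    scale {x} {y} x<y = <-respʳ-≈ (trans (distribˡ k y _) (+-congˡ
      (trans (sym (*-assoc k _ ε)) (trans (*-congʳ (recip-inverseʳ k 0<k)) (*-identityˡ ε)))))
      (*-monoʳ-< 0<k x<y)

  ⟶-sub : ∀ {u v x y} → u ⟶ x → v ⟶ y → (λ n → u n - v n) ⟶ x - y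
  ⟶-sub {u} {v} {x} {y} u⟶x v⟶y ε 0<ε =
    let M , u-close = u⟶x (half * ε) (*-positive half-positive 0<ε)
        N , v-close = v⟶y (half * ε) (*-positive half-positive 0<ε)
    in M ℕ.+ N , λ n M+N≤n →
      let u<x , x<u = u-close n (ℕ.≤-trans (ℕ.m≤m+n M N) M+N≤n)
          v<y , y<v = v-close n (ℕ.≤-trans (ℕ.m≤n+m N M) M+N≤n)
      in subtract u<x y<v , subtract x<u v<y
    where
    subtract : ∀ {a b c d} → a < b + half * ε → c < d + half * ε → a - d < (b - c) + ε
    subtract {a} {b} {c} {d} a<b c<d = <-by-difference
      (0<x+y (x<y⇒0<y-x a<b) (<⇒≤ (x<y⇒0<y-x c<d)))
      (trans (+-congʳ (+-congˡ (sym (halves ε))))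
        (solve 5 (λ a b c d h → ((b :- c) :+ (h :+ h)) :- (a :- d)
                              := ((b :+ h) :- a) :+ ((d :+ h) :- c)) refl a b c d (half * ε)))

  limit-≤-null : ∀ {u e x a} → u ⟶ x → IsNull e → (K : ℕ) →
                 (∀ n → K ℕ.≤ n → u n ≤ a + e n) → x ≤ a
  limit-≤-null {u} {e} {x} {a} u⟶x null K u≤a+e a<x =
    let 0<δ = *-positive half-positive (x<y⇒0<y-x a<x)
        M , close = u⟶x δ 0<δ
        N , e<δ = null δ 0<δ
        n = K ℕ.+ (M ℕ.+ N)
        M+N≤n = ℕ.m≤n+m (M ℕ.+ N) K
    in u≤a+e n (ℕ.m≤m+n K _) (<-by-difference
      (0<x+y (x<y⇒0<y-x (proj₂ (close n (ℕ.≤-trans (ℕ.m≤m+n M N) M+N≤n))))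
             (<⇒≤ (x<y⇒0<y-x (e<δ n (ℕ.≤-trans (ℕ.m≤n+m N M) M+N≤n)))))
      (trans (solve 5 (λ u x a d e → u :- (a :+ e) := ((u :+ d) :- x) :+ (d :- e) :+ ((x :- a) :- (d :+ d)))
               refl (u n) x a δ (e n))
        (trans (+-congˡ (trans (+-congˡ (-‿cong (halves (x - a)))) (-‿inverseʳ _))) (+-identityʳ _))))
    where δ = half * (x - a)

  -- Finite sums and Cauchy products

  Σ : (ℕ → Carrier) → ℕ → Carrier
  Σ f ℕ.zero = 0#
  Σ f (suc N) = f 0 + Σ (f ∘ suc) N

  Σ-cong : ∀ {f g} → (∀ k → f k ≈ g k) → ∀ N → Σ f N ≈ Σ g N
  Σ-cong f≈g ℕ.zero = refl
  Σ-cong f≈g (suc N) = +-cong (f≈g 0) (Σ-cong (f≈g ∘ suc) N)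

  Σ-last : ∀ f N → Σ f (suc N) - Σ f N ≈ f N
  Σ-last f ℕ.zero = solve 1 (λ x → (x :+ con 0ℤ) :- con 0ℤ := x) refl (f 0)
  Σ-last f (suc N) = trans
    (solve 3 (λ x y z → (x :+ y) :- (x :+ z) := y :- z) refl (f 0) (Σ (f ∘ suc) (suc N)) (Σ (f ∘ suc) N))
    (Σ-last (f ∘ suc) N)

  Σ-distrib-+ : ∀ f g N → Σ (λ k → f k + g k) N ≈ Σ f N + Σ g N
  Σ-distrib-+ f g ℕ.zero = sym (+-identityʳ 0#)
  Σ-distrib-+ f g (suc N) = trans (+-congˡ (Σ-distrib-+ _ _ N))
    (solve 4 (λ a b c d → (a :+ b) :+ (c :+ d) := (a :+ c) :+ (b :+ d)) refl (f 0) (g 0) _ _)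

  *-distribˡ-Σ : ∀ x f N → x * Σ f N ≈ Σ (λ k → x * f k) N
  *-distribˡ-Σ x f ℕ.zero = zeroʳ x
  *-distribˡ-Σ x f (suc N) = trans (distribˡ x _ _) (+-congˡ (*-distribˡ-Σ x _ N))

  0≤Σ : ∀ {f} → (∀ k → 0# ≤ f k) → ∀ N → 0# ≤ Σ f N
  0≤Σ 0≤f ℕ.zero = ≤-refl
  0≤Σ 0≤f (suc N) = 0≤x+y (0≤f 0) (0≤Σ (0≤f ∘ suc) N)

  Σ-monoˡ-≤ : ∀ {f g} → (∀ k → f k ≤ g k) → ∀ N → Σ f N ≤ Σ g N
  Σ-monoˡ-≤ f≤g ℕ.zero = ≤-refl
  Σ-monoˡ-≤ f≤g (suc N) = +-mono-≤ (f≤g 0) (Σ-monoˡ-≤ (f≤g ∘ suc) N)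

  Σ-monoʳ-≤ : ∀ {f} → (∀ k → 0# ≤ f k) → ∀ {M N} → M ℕ.≤ N → Σ f M ≤ Σ f N
  Σ-monoʳ-≤ 0≤f {N = N} ℕ.z≤n = 0≤Σ 0≤f N
  Σ-monoʳ-≤ 0≤f (ℕ.s≤s M≤N) = +-monoʳ-≤ _ (Σ-monoʳ-≤ (0≤f ∘ suc) M≤N)

  ∣Σ∣≤ : ∀ {f F} → (∀ k → ∣ f k ∣≤ F k) → ∀ N → ∣ Σ f N ∣≤ Σ F N
  ∣Σ∣≤ ∣f∣≤F ℕ.zero = ∣x∣≤x ≤-refl
  ∣Σ∣≤ ∣f∣≤F (suc N) = ∣∣≤-+ (∣f∣≤F 0) (∣Σ∣≤ (∣f∣≤F ∘ suc) N)

  ∣Σ-Σ∣≤ : ∀ {f F} → (∀ k → ∣ f k ∣≤ F k) → ∀ {M N} → M ℕ.≤ N →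
           ∣ Σ f N - Σ f M ∣≤ Σ F N - Σ F M
  ∣Σ-Σ∣≤ ∣f∣≤F {N = N} ℕ.z≤n = ∣∣≤-cong (drop _) (drop _) (∣Σ∣≤ ∣f∣≤F N)
    where
    drop : ∀ x → x ≈ x - 0#
    drop = solve 1 (λ x → x := x :- con 0ℤ) refl
  ∣Σ-Σ∣≤ ∣f∣≤F (ℕ.s≤s M≤N) = ∣∣≤-cong (shift _ _ _) (shift _ _ _) (∣Σ-Σ∣≤ (∣f∣≤F ∘ suc) M≤N)
    where
    shift : ∀ x y z → y - z ≈ (x + y) - (x + z)
    shift = solve 3 (λ x y z → y :- z := (x :+ y) :- (x :+ z)) refl

  -- The Cauchy product coefficient, the sum of f(i) g(j) over i + j = m.
  conv : (f g : ℕ → Carrier) → ℕ → Carrier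
  conv f g ℕ.zero = f 0 * g 0
  conv f g (suc m) = f 0 * g (suc m) + conv (f ∘ suc) g m

  -- The sum of f(i) g(j) over the triangle i + j < N, taken row by row so that it can be compared
  -- with the rectangle `Σ f N * Σ g M`.
  Σconv : (f g : ℕ → Carrier) → ℕ → Carrier
  Σconv f g ℕ.zero = 0#
  Σconv f g (suc N) = f 0 * Σ g (suc N) + Σconv (f ∘ suc) g N

  Σconv≈Σ[conv] : ∀ f g N → Σconv f g N ≈ Σ (conv f g) N
  Σconv≈Σ[conv] f g ℕ.zero = refl
  Σconv≈Σ[conv] f g (suc N) = begin-equality
    f 0 * (g 0 + Σ (g ∘ suc) N) + Σconv (f ∘ suc) g N
      ≈⟨ +-cong (distribˡ _ _ _) (Σconv≈Σ[conv] (f ∘ suc) g N) ⟩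
    f 0 * g 0 + f 0 * Σ (g ∘ suc) N + Σ (conv (f ∘ suc) g) N
      ≈⟨ +-assoc _ _ _ ⟩
    f 0 * g 0 + (f 0 * Σ (g ∘ suc) N + Σ (conv (f ∘ suc) g) N)
      ≈⟨ +-congˡ (+-congʳ (*-distribˡ-Σ (f 0) (g ∘ suc) N)) ⟩
    f 0 * g 0 + (Σ (λ m → f 0 * g (suc m)) N + Σ (conv (f ∘ suc) g) N)
      ≈⟨ +-congˡ (Σ-distrib-+ _ _ N) ⟨
    f 0 * g 0 + Σ (λ m → f 0 * g (suc m) + conv (f ∘ suc) g m) N
      ∎
    where open ≤-Reasoning

  -- For N ≤ M the triangle i + j < N lies in the rectangle i < N, j < M. The same pairs are left
  -- over on both sides, and there F G dominates f g term by term.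
  ∣ΣΣ-Σconv∣≤ : ∀ {f g F G} → (∀ k → ∣ f k ∣≤ F k) → (∀ k → ∣ g k ∣≤ G k) →
                ∀ {N M} → N ℕ.≤ M →
                ∣ Σ f N * Σ g M - Σconv f g N ∣≤ Σ F N * Σ G M - Σconv F G N
  ∣ΣΣ-Σconv∣≤ {g = g} {G = G} ∣f∣≤F ∣g∣≤G {ℕ.zero} {M} _ =
    ∣∣≤-cong (nil (Σ g M)) (nil (Σ G M)) (∣x∣≤x ≤-refl)
    where
    nil : ∀ x → 0# ≈ 0# * x - 0#
    nil = solve 1 (λ x → con 0ℤ := con 0ℤ :* x :- con 0ℤ) refl
  ∣ΣΣ-Σconv∣≤ {f} {g} {F} {G} ∣f∣≤F ∣g∣≤G {suc N} {M} N<M =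
    ∣∣≤-cong (regroup _ _ _ _ _) (regroup _ _ _ _ _)
      (∣∣≤-+ (∣∣≤-* (∣f∣≤F 0) (∣Σ-Σ∣≤ ∣g∣≤G N<M))
             (∣ΣΣ-Σconv∣≤ (∣f∣≤F ∘ suc) ∣g∣≤G (ℕ.<⇒≤ N<M)))
    where
    regroup : ∀ a s p q r → a * (q - p) + (s * q - r) ≈ (a + s) * q - (a * p + r)
    regroup = solve 5 (λ a s p q r → a :* (q :- p) :+ (s :* q :- r)
                                  := (a :+ s) :* q :- (a :* p :+ r)) refl

  -- The rectangle i < N, j < M lies in the triangle i + j < N + M, and no term is negative.
  ΣΣ≤Σconv : ∀ {F G} → (∀ k → 0# ≤ F k) → (∀ k → 0# ≤ G k) →
             ∀ N M → Σ F N * Σ G M ≤ Σconv F G (N ℕ.+ M)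
  ΣΣ≤Σconv {F} {G} 0≤F 0≤G ℕ.zero M = ≤-trans (≤-reflexive (zeroˡ _)) (0≤Σconv F 0≤F M)
    where
    0≤Σconv : ∀ F → (∀ k → 0# ≤ F k) → ∀ N → 0# ≤ Σconv F G N
    0≤Σconv F 0≤F ℕ.zero = ≤-refl
    0≤Σconv F 0≤F (suc N) = 0≤x+y (0≤x*y (0≤F 0) (0≤Σ 0≤G (suc N)))
      (0≤Σconv (F ∘ suc) (0≤F ∘ suc) N)
  ΣΣ≤Σconv 0≤F 0≤G (suc N) M = ≤-trans (≤-reflexive (distribʳ _ _ _))
    (+-mono-≤ (*-monoʳ-≤ (0≤F 0) (Σ-monoʳ-≤ 0≤G (ℕ.≤-trans (ℕ.m≤n+m M N) (ℕ.n≤1+n _))))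
      (ΣΣ≤Σconv (0≤F ∘ suc) 0≤G N M))

  conv-cong : ∀ {f f′ g g′} → (∀ k → f k ≈ f′ k) → (∀ k → g k ≈ g′ k) →
              ∀ m → conv f g m ≈ conv f′ g′ m
  conv-cong f≈f′ g≈g′ ℕ.zero = *-cong (f≈f′ 0) (g≈g′ 0)
  conv-cong f≈f′ g≈g′ (suc m) = +-cong (*-cong (f≈f′ 0) (g≈g′ (suc m)))
    (conv-cong (f≈f′ ∘ suc) g≈g′ m)

  conv-distribʳ-+ : ∀ f f′ g m → conv (λ k → f k + f′ k) g m ≈ conv f g m + conv f′ g m
  conv-distribʳ-+ f f′ g ℕ.zero = distribʳ _ _ _
  conv-distribʳ-+ f f′ g (suc m) = trans (+-congˡ (conv-distribʳ-+ _ _ g m))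
    (solve 5 (λ a b g c d → (a :+ b) :* g :+ (c :+ d) := (a :* g :+ c) :+ (b :* g :+ d))
      refl (f 0) (f′ 0) (g (suc m)) _ _)

  conv-scaleˡ : ∀ x f g m → conv (λ k → x * f k) g m ≈ x * conv f g m
  conv-scaleˡ x f g ℕ.zero = *-assoc _ _ _
  conv-scaleˡ x f g (suc m) = trans (+-cong (*-assoc _ _ _) (conv-scaleˡ x _ g m))
    (sym (distribˡ _ _ _))

  conv-scaleʳ : ∀ x f g m → conv f (λ k → x * g k) m ≈ x * conv f g m
  conv-scaleʳ x f g ℕ.zero = solve 3 (λ x f g → f :* (x :* g) := x :* (f :* g)) refl x (f 0) (g 0)
  conv-scaleʳ x f g (suc m) = trans (+-congˡ (conv-scaleʳ x _ g m))
    (solve 4 (λ x f g c → f :* (x :* g) :+ x :* c := x :* (f :* g :+ c)) refl x (f 0) (g (suc m)) _)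

  derivative : (ℕ → Carrier) → ℕ → Carrier
  derivative f k = fromℕ (suc k) * f (suc k)

  -- The Leibniz rule for formal power series; thanks to it the addition law `conv-term` needs no
  -- binomial coefficients.
  conv-leibniz : ∀ f g m → derivative (conv f g) m ≈ conv (derivative f) g m + conv f (derivative g) m
  conv-leibniz f g ℕ.zero = solve 4
    (λ f₀ f₁ g₀ g₁ → con (+ 1) :* (f₀ :* g₁ :+ f₁ :* g₀)
                  := (con (+ 1) :* f₁) :* g₀ :+ f₀ :* (con (+ 1) :* g₁)) refl (f 0) (f 1) (g 0) (g 1)
  conv-leibniz f g (suc m) = begin-equality
    (1# + k) * (f 0 * g (suc (suc m)) + (f 1 * g (suc m) + conv (f ∘ 2+_) g m))
      -- For f = f(0) + X h the derivative is h + X h'. The copy split off here is a coefficient of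
      -- h g, and k times it is one of (h g)', to which induction applies.
      ≈⟨ solve 3 (λ k a b → (:1 :+ k) :* (a :+ b) := (:1 :+ k) :* a :+ (b :+ k :* b))
           refl k (f 0 * g (suc (suc m))) (f 1 * g (suc m) + conv (f ∘ 2+_) g m) ⟩
    (1# + k) * (f 0 * g (suc (suc m))) + (f 1 * g (suc m) + conv (f ∘ 2+_) g m + derivative (conv (f ∘ suc) g) m)
      ≈⟨ +-congˡ (+-congˡ (conv-leibniz (f ∘ suc) g m)) ⟩
    (1# + k) * (f 0 * g (suc (suc m))) + (f 1 * g (suc m) + conv (f ∘ 2+_) g m
      + (conv (derivative (f ∘ suc)) g m + conv (f ∘ suc) (derivative g) m))
      ≈⟨ solve 8 (λ k f₀ f₁ g₁ g₂ c₁ c₂ c₃ →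
             (:1 :+ k) :* (f₀ :* g₂) :+ (f₁ :* g₁ :+ c₁ :+ (c₂ :+ c₃))
          := ((con (+ 1) :* f₁) :* g₁ :+ (c₁ :+ c₂)) :+ (f₀ :* ((:1 :+ k) :* g₂) :+ c₃))
          refl k (f 0) (f 1) (g (suc m)) (g (suc (suc m))) _ _ _ ⟩
    ((fromℕ 1 * f 1) * g (suc m) + (conv (f ∘ 2+_) g m + conv (derivative (f ∘ suc)) g m))
      + conv f (derivative g) (suc m)
      ≈⟨ +-congʳ (+-congˡ (trans
           (conv-cong
             (λ i → solve 2 (λ i x → (:1 :+ i) :* x := x :+ i :* x) refl (fromℕ (suc i)) (f (suc (suc i))))
             (λ _ → refl) m)
           (conv-distribʳ-+ (f ∘ 2+_) (derivative (f ∘ suc)) g m))) ⟨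
    conv (derivative f) g (suc m) + conv f (derivative g) (suc m)
      ∎
    where
    open ≤-Reasoning
    2+_ = λ n → suc (suc n)
    k = fromℕ (suc m)

  -- The exponential series

  1/suc : ℕ → Carrier
  1/suc k = recip (fromℕ (suc k)) (fromℕ-positive (suc k))

  0≤1/suc : ∀ k → 0# ≤ 1/suc k
  0≤1/suc k = <⇒≤ (recip-positive (fromℕ (suc k)) (fromℕ-positive (suc k)))

  -- x^k / k!, by a recursion that avoids factorials and makes the ratio of consecutive terms
  -- explicit.
  expTerm : Carrier → ℕ → Carrier
  expTerm x ℕ.zero = 1#
  expTerm x (suc k) = (x * expTerm x k) * 1/suc k

  term-one : ∀ x → expTerm x 1 ≈ x
  term-one x = trans (solve 2 (λ x i → (x :* :1) :* i := x :* (con (+ 1) :* i)) refl x (1/suc 0))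
    (trans (*-congˡ (recip-inverseʳ (fromℕ 1) (fromℕ-positive 1))) (*-identityʳ x))

  derivative-term : ∀ x k → derivative (expTerm x) k ≈ x * expTerm x k
  derivative-term x k = trans
    (solve 3 (λ n a i → n :* (a :* i) := (n :* i) :* a) refl (fromℕ (suc k)) (x * expTerm x k) (1/suc k))
    (trans (*-congʳ (recip-inverseʳ (fromℕ (suc k)) (fromℕ-positive (suc k)))) (*-identityˡ _))

  -- The addition law of the exponential: both sides are 1 in degree 0 and satisfy (m + 1) c_{m+1} =
  -- (x + y) c_m.
  conv-term : ∀ x y m → conv (expTerm x) (expTerm y) m ≈ expTerm (x + y) m
  conv-term x y ℕ.zero = *-identityˡ 1#
  conv-term x y (suc m) = *-cancelˡ-≈ (fromℕ-positive (suc m)) (begin-equality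
    derivative (conv (expTerm x) (expTerm y)) m  ≈⟨ conv-leibniz (expTerm x) (expTerm y) m ⟩
    conv (derivative (expTerm x)) (expTerm y) m + conv (expTerm x) (derivative (expTerm y)) m
      ≈⟨ +-cong (trans (conv-cong (derivative-term x) (λ _ → refl) m) (conv-scaleˡ x (expTerm x) (expTerm y) m))
                (trans (conv-cong (λ _ → refl) (derivative-term y) m) (conv-scaleʳ y (expTerm x) (expTerm y) m)) ⟩
    x * conv (expTerm x) (expTerm y) m + y * conv (expTerm x) (expTerm y) m ≈⟨ distribʳ _ x y ⟨
    (x + y) * conv (expTerm x) (expTerm y) m     ≈⟨ *-congˡ (conv-term x y m) ⟩
    (x + y) * expTerm (x + y) m               ≈⟨ derivative-term (x + y) m ⟨
    derivative (expTerm (x + y)) m            ∎)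
    where open ≤-Reasoning

  ∣term∣≤ : ∀ {x a} → ∣ x ∣≤ a → ∀ k → ∣ expTerm x k ∣≤ expTerm a k
  ∣term∣≤ ∣x∣≤a ℕ.zero = ∣x∣≤x 0≤1
  ∣term∣≤ ∣x∣≤a (suc k) = ∣∣≤-* (∣∣≤-* ∣x∣≤a (∣term∣≤ ∣x∣≤a k)) (∣x∣≤x (0≤1/suc k))

  0≤term : ∀ {x} → 0# ≤ x → ∀ k → 0# ≤ expTerm x k
  0≤term 0≤x ℕ.zero = 0≤1
  0≤term 0≤x (suc k) = 0≤x*y (0≤x*y 0≤x (0≤term 0≤x k)) (0≤1/suc k)

  expΣ : Carrier → ℕ → Carrier
  expΣ x = Σ (expTerm x)

  Σconv-term : ∀ x y N → Σconv (expTerm x) (expTerm y) N ≈ expΣ (x + y) N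
  Σconv-term x y N = trans (Σconv≈Σ[conv] (expTerm x) (expTerm y) N) (Σ-cong (conv-term x y) N)

  expΣ-* : ∀ {x y} → 0# ≤ x → 0# ≤ y → ∀ M N → expΣ x M * expΣ y N ≤ expΣ (x + y) (M ℕ.+ N)
  expΣ-* {x} {y} 0≤x 0≤y M N = ≤-trans (ΣΣ≤Σconv (0≤term 0≤x) (0≤term 0≤y) M N)
    (≤-reflexive (Σconv-term x y (M ℕ.+ N)))

  expΣ-mono-≤ : ∀ {x y} → 0# ≤ x → x ≤ y → ∀ N → expΣ x N ≤ expΣ y N
  expΣ-mono-≤ 0≤x x≤y = Σ-monoˡ-≤ λ k → proj₂ (∣term∣≤ (∣∣≤-weaken x≤y (∣x∣≤x 0≤x)) k)

  -- The ratio x / (k + 1) of consecutive terms is at most 1/2 as soon as k + 1 ≥ 2x.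
  term-halving : ∀ {x} → 0# ≤ x → ∀ K → x + x ≤ fromℕ (suc K) →
                 ∀ k → K ℕ.≤ k → expTerm x (suc k) + expTerm x (suc k) ≤ expTerm x k
  term-halving {x} 0≤x K 2x≤K k K≤k = *-cancelˡ-≤ (fromℕ-positive (suc k)) (begin
    fromℕ (suc k) * (expTerm x (suc k) + expTerm x (suc k)) ≈⟨ distribˡ _ _ _ ⟩
    derivative (expTerm x) k + derivative (expTerm x) k  ≈⟨ +-cong (derivative-term x k) (derivative-term x k) ⟩
    x * expTerm x k + x * expTerm x k                    ≈⟨ distribʳ _ x x ⟨
    (x + x) * expTerm x k                             ≤⟨ *-monoˡ-≤ (0≤term 0≤x k)
                                                        (≤-trans 2x≤K (fromℕ-mono-≤ (ℕ.s≤s K≤k))) ⟩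
    fromℕ (suc k) * expTerm x k                        ∎)
    where open ≤-Reasoning

  module TermEnvelope {x} (0≤x : 0# ≤ x) (K : ℕ) (2x≤K : x + x ≤ fromℕ (suc K)) where

    -- Twice the first omitted term bounds the tail of the series: once terms halve, `bound` drops
    -- by at least one term per step.
    bound : ℕ → Carrier
    bound k = expTerm x k + expTerm x k

    0≤bound : ∀ k → 0# ≤ bound k
    0≤bound k = 0≤x+y (0≤term 0≤x k) (0≤term 0≤x k)

    ∣∣≤-term⇒step : ∀ {a k} → K ℕ.≤ k → ∣ a ∣≤ expTerm x k → ∣ a ∣≤ bound k - bound (suc k)
    ∣∣≤-term⇒step {k = k} K≤k = ∣∣≤-weaken (≤-by-difference
      (x≤y⇒0≤y-x (term-halving 0≤x K 2x≤K k K≤k))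
      (solve 2 (λ s t → ((s :+ s) :- (t :+ t)) :- s := s :- (t :+ t)) refl (expTerm x k) (expTerm x (suc k))))

    private
      term-antitone : ∀ {n} → K ℕ.≤′ n → expTerm x n ≤ expTerm x K
      term-antitone (ℕ.≤′-reflexive ≡.refl) = ≤-refl
      term-antitone (ℕ.≤′-step {n} K≤n) = ≤-trans
        (≤-trans (≤-by-difference (0≤term 0≤x (suc n)) (solve 1 (λ t → (t :+ t) :- t := t) refl (expTerm x (suc n))))
          (term-halving 0≤x K 2x≤K n (ℕ.≤′⇒≤ K≤n)))
        (term-antitone K≤n)

    -- Beyond K the terms are at most the K-th, so the factor x / (n + 1) by itself makes them
    -- small.
    term-null : IsNull (expTerm x)
    term-null ε 0<ε = suc (K ℕ.+ m) , small
      where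
      open ≤-Reasoning
      1/ε = recip ε 0<ε
      A = 1/ε * (x * expTerm x K)
      m = proj₁ (archimedean A)

      small : ∀ n → suc (K ℕ.+ m) ℕ.≤ n → expTerm x n < ε
      small (suc n) (ℕ.s≤s K+m≤n) = *-cancelˡ-< (fromℕ-positive (suc n)) (begin-strict
        derivative (expTerm x) n  ≈⟨ derivative-term x n ⟩
        x * expTerm x n           ≤⟨ *-monoʳ-≤ 0≤x (term-antitone (ℕ.≤⇒≤′ (ℕ.≤-trans (ℕ.m≤m+n K m) K+m≤n))) ⟩
        x * expTerm x K           ≈⟨ trans (*-congʳ (recip-inverseʳ ε 0<ε)) (*-identityˡ _) ⟨
        (ε * 1/ε) * (x * expTerm x K)  ≈⟨ *-assoc _ _ _ ⟩
        ε * A                  <⟨ *-monoʳ-< 0<ε (proj₂ (archimedean A)) ⟩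
        ε * fromℕ m            ≤⟨ *-monoʳ-≤ (<⇒≤ 0<ε) (fromℕ-mono-≤
                                    (ℕ.≤-trans (ℕ.m≤n+m m K) (ℕ.≤-trans K+m≤n (ℕ.n≤1+n n)))) ⟩
        ε * fromℕ (suc n)       ≈⟨ *-comm _ _ ⟩
        fromℕ (suc n) * ε       ∎)

    bound-null : IsNull bound
    bound-null ε 0<ε =
      let N , bound<ε = null-* (fromℕ-positive 2) term-null ε 0<ε in
      N , λ n N≤n → <-respˡ-≈ (solve 1 (λ t → con (+ 2) :* t := t :+ t) refl (expTerm x n)) (bound<ε n N≤n)

  Σ-zero : ∀ {f} → (∀ k → f k ≈ 0#) → ∀ N → Σ f N ≈ 0#
  Σ-zero f≈0 ℕ.zero = refl
  Σ-zero f≈0 (suc N) = trans (+-cong (f≈0 0) (Σ-zero (f≈0 ∘ suc) N)) (+-identityʳ 0#)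

  expΣ-≈0 : ∀ {x} → x ≈ 0# → ∀ N → expΣ x (suc N) ≈ 1#
  expΣ-≈0 x≈0 N = trans
    (+-congˡ (Σ-zero (λ k → trans (*-congʳ (trans (*-congʳ x≈0) (zeroˡ _))) (zeroˡ _)) N))
    (+-identityʳ 1#)

  module ExpNegation {x} (0≤x : 0# ≤ x) where

    private
      2x = x + x
      0≤2x = 0≤x+y 0≤x 0≤x
      K = proj₁ (archimedean (2x + 2x))

    open TermEnvelope 0≤2x K
      (≤-trans (<⇒≤ (proj₂ (archimedean (2x + 2x)))) (fromℕ-mono-≤ (ℕ.n≤1+n K)))

    private
      open Envelope (expΣ 2x) bound K 0≤bound
        (λ n K≤n → ∣∣≤-term⇒step K≤n (∣∣≤-cong (sym (Σ-last (expTerm 2x) n)) refl (∣x∣≤x (0≤term 0≤2x n))))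
        using (difference)

      -- The triangle part of the product is a partial sum of exp 0, that is 1. The rest is
      -- dominated by its analogue for x and x, hence by the stretch of the series at 2x from N to
      -- 2N, which its tail bound controls.
      product-≤ : ∀ n → K ℕ.≤ n → expΣ (- x) (suc n) * expΣ x (suc n) ≤ 1# + bound (suc n)
      product-≤ n K≤n = begin
        P * E              ≈⟨ solve 2 (λ p d → p := (p :- d) :+ d) refl (P * E) D ⟩
        (P * E - D) + D    ≤⟨ +-mono-≤
          (proj₂ (∣ΣΣ-Σconv∣≤ (∣term∣≤ (∣∣≤-neg (∣x∣≤x 0≤x))) (∣term∣≤ (∣x∣≤x 0≤x)) {N} ℕ.≤-refl))
          (≤-reflexive (trans (Σconv-term (- x) x N) (expΣ-≈0 (-‿inverseˡ x) n))) ⟩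
        (E * E - Σconv (expTerm x) (expTerm x) N) + 1#
          ≤⟨ +-monoˡ-≤ 1# (+-mono-≤ (expΣ-* 0≤x 0≤x N N) (≤-reflexive (-‿cong (Σconv-term x x N)))) ⟩
        (expΣ 2x (N ℕ.+ N) - expΣ 2x N) + 1#
          ≤⟨ +-monoˡ-≤ 1# (proj₂ (difference (ℕ.≤-trans K≤n (ℕ.n≤1+n n)) (ℕ.m≤m+n N N))) ⟩
        bound N + 1#       ≈⟨ +-comm _ _ ⟩
        1# + bound N       ∎
        where
        open ≤-Reasoning
        N = suc n
        P = expΣ (- x) N
        E = expΣ x N
        D = Σconv (expTerm (- x)) (expTerm x) N

    -- The inequality exp (-x) exp x ≤ 1 with partial sums in place of exp x. For v > 0, the fixed
    -- sum up to M is enlarged to n terms and multiplied by the partial sum at -x before n tends to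
    -- infinity.
    limit-*-expΣ≤1 : ∀ {v} → expΣ (- x) ⟶ v → ∀ M → v * expΣ x M ≤ 1#
    limit-*-expΣ≤1 {v} lim M = ≤-by-cases
      (λ 0<v → ≤-by-cases (λ 0<p → positive-case 0<v 0<p) (λ p≤0 → ≤-trans (*-monoʳ-≤ (<⇒≤ 0<v) p≤0)
        (≤-trans (≤-reflexive (zeroʳ v)) 0≤1)))
      (λ v≤0 → ≤-trans (*-monoˡ-≤ 0≤p v≤0) (≤-trans (≤-reflexive (zeroˡ p)) 0≤1))
      where
      p = expΣ x M
      0≤p = 0≤Σ (0≤term 0≤x) M

      positive-case : 0# < v → 0# < p → v * p ≤ 1#
      positive-case 0<v 0<p = ≤-trans (≤-reflexive (*-comm v p))
        (limit-≤-null (*-limit 0<p lim) bound-null (suc (K ℕ.+ (M ℕ.+ proj₁ near))) eventually)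
        where
        -- Within distance v of v the partial sums at -x are positive, as enlarging the other factor
        -- requires.
        near = lim v 0<v

        eventually : ∀ n → suc (K ℕ.+ (M ℕ.+ proj₁ near)) ℕ.≤ n → p * expΣ (- x) n ≤ 1# + bound n
        eventually (suc n) (ℕ.s≤s K+M+N≤n) = ≤-trans (≤-reflexive (*-comm p _))
          (≤-trans
            (*-monoʳ-≤ (<⇒≤ (<-by-difference (x<y⇒0<y-x (proj₂ (proj₂ near (suc n) N≤1+n)))
                (solve 2 (λ e v → e :- con 0ℤ := (e :+ v) :- v) refl (expΣ (- x) (suc n)) v)))
              (Σ-monoʳ-≤ (0≤term 0≤x) M≤1+n))
            (product-≤ n (ℕ.≤-trans (ℕ.m≤m+n K _) K+M+N≤n)))
          where
          M+N≤1+n = ℕ.≤-trans (ℕ.m≤n+m (M ℕ.+ proj₁ near) K) (ℕ.≤-trans K+M+N≤n (ℕ.n≤1+n n))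
          M≤1+n = ℕ.≤-trans (ℕ.m≤m+n M _) M+N≤1+n
          N≤1+n = ℕ.≤-trans (ℕ.m≤n+m _ M) M+N≤1+n

  -- Complex numbers

  ℂ-commutativeRing : CommutativeRing c ℓ₁
  ℂ-commutativeRing = record
    { RawRing ℂ-rawRing
    ; isCommutativeRing = record
      { isRing = record
        { +-isAbelianGroup = record
          { isGroup = record
            { isMonoid = record
              { isSemigroup = record
                { isMagma = record
                  { isEquivalence = record
                    { refl = refl , refl
                    ; sym = λ (p , q) → sym p , sym q
                    ; trans = λ (p , q) (r , s) → trans p r , trans q s
                    }
                  ; ∙-cong = λ (p , q) (r , s) → +-cong p r , +-cong q s
                  }
                ; assoc = λ _ _ _ → +-assoc _ _ _ , +-assoc _ _ _
                }
              ; identity = (λ _ → +-identityˡ _ , +-identityˡ _) , (λ _ → +-identityʳ _ , +-identityʳ _)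
              }
            ; inverse = (λ _ → -‿inverseˡ _ , -‿inverseˡ _) , (λ _ → -‿inverseʳ _ , -‿inverseʳ _)
            ; ⁻¹-cong = λ (p , q) → -‿cong p , -‿cong q
            }
          ; comm = λ _ _ → +-comm _ _ , +-comm _ _
          }
        ; *-cong = λ (p , q) (r , s) →
            +-cong (*-cong p r) (-‿cong (*-cong q s)) , +-cong (*-cong p s) (*-cong q r)
        ; *-assoc = λ z w v →
            solve 6 (λ a b c d e f → (a :* c :- b :* d) :* e :- (a :* d :+ b :* c) :* f
                                  := a :* (c :* e :- d :* f) :- b :* (c :* f :+ d :* e))
              refl (re z) (im z) (re w) (im w) (re v) (im v) ,
            solve 6 (λ a b c d e f → (a :* c :- b :* d) :* f :+ (a :* d :+ b :* c) :* e
                                  := a :* (c :* f :+ d :* e) :+ b :* (c :* e :- d :* f))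
              refl (re z) (im z) (re w) (im w) (re v) (im v)
        ; *-identity =
            (λ z → solve 2 (λ a b → :1 :* a :- con 0ℤ :* b := a) refl (re z) (im z) ,
                   solve 2 (λ a b → :1 :* b :+ con 0ℤ :* a := b) refl (re z) (im z)) ,
            (λ z → solve 2 (λ a b → a :* :1 :- b :* con 0ℤ := a) refl (re z) (im z) ,
                   solve 2 (λ a b → a :* con 0ℤ :+ b :* :1 := b) refl (re z) (im z))
        ; distrib =
            (λ z w v →
              solve 6 (λ a b c d e f → a :* (c :+ e) :- b :* (d :+ f)
                                    := (a :* c :- b :* d) :+ (a :* e :- b :* f))
                refl (re z) (im z) (re w) (im w) (re v) (im v) ,
              solve 6 (λ a b c d e f → a :* (d :+ f) :+ b :* (c :+ e)
                                    := (a :* d :+ b :* c) :+ (a :* f :+ b :* e))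
                refl (re z) (im z) (re w) (im w) (re v) (im v)) ,
            (λ z w v →
              solve 6 (λ a b c d e f → (c :+ e) :* a :- (d :+ f) :* b
                                    := (c :* a :- d :* b) :+ (e :* a :- f :* b))
                refl (re z) (im z) (re w) (im w) (re v) (im v) ,
              solve 6 (λ a b c d e f → (c :+ e) :* b :+ (d :+ f) :* a
                                    := (c :* b :+ d :* a) :+ (e :* b :+ f :* a))
                refl (re z) (im z) (re w) (im w) (re v) (im v))
        }
      ; *-comm = λ z w →
          solve 4 (λ a b c d → a :* c :- b :* d := c :* a :- d :* b)
            refl (re z) (im z) (re w) (im w) ,
          solve 4 (λ a b c d → a :* d :+ b :* c := c :* b :+ d :* a)
            refl (re z) (im z) (re w) (im w)
      }
    }

  private
    module ℂᶜ = CommutativeRing ℂ-commutativeRing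
    module ℂ-Sum = Sum ℂᶜ.semiring
  open Polynomials ℂ-commutativeRing

  normSq : ℂ → Carrier
  normSq z = re z * re z + im z * im z

  normSq-cong : ∀ {z w} → z ℂᵣ.≈ w → normSq z ≈ normSq w
  normSq-cong (p , q) = +-cong (*-cong p p) (*-cong q q)

  normSq-* : ∀ z w → normSq (z ℂᵣ.* w) ≈ normSq z * normSq w
  normSq-* z w = solve 4
    (λ a b c d → (a :* c :- b :* d) :* (a :* c :- b :* d) :+ (a :* d :+ b :* c) :* (a :* d :+ b :* c)
              := (a :* a :+ b :* b) :* (c :* c :+ d :* d)) refl (re z) (im z) (re w) (im w)

  0≤normSq : ∀ z → 0# ≤ normSq z
  0≤normSq z = 0≤x+y (0≤x² (re z)) (0≤x² (im z))

  normSq-neg : ∀ z → normSq (ℂᵣ.- z) ≈ normSq z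
  normSq-neg z = solve 2 (λ a b → (:- a) :* (:- a) :+ (:- b) :* (:- b) := a :* a :+ b :* b)
    refl (re z) (im z)

  -- The parallelogram law: the two sides differ by |z - w|².
  normSq-+ : ∀ z w → normSq (z ℂᵣ.+ w) ≤ fromℕ 2 * (normSq z + normSq w)
  normSq-+ z w = ≤-by-difference (0≤normSq (z ℂᵣ.+ (ℂᵣ.- w)))
    (solve 4 (λ a b c d →
         con (+ 2) :* ((a :* a :+ b :* b) :+ (c :* c :+ d :* d)) :- ((a :+ c) :* (a :+ c) :+ (b :+ d) :* (b :+ d))
      := (a :- c) :* (a :- c) :+ (b :- d) :* (b :- d)) refl (re z) (im z) (re w) (im w))

  termℂ : ℂ → ℕ → ℂ
  termℂ w k = ofReal (1/ k !) ℂᵣ.* (w ℂᵣ.^ k)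

  1/0!≈1 : 1/ 0 ! ≈ 1#
  1/0!≈1 = trans (solve 1 (λ x → x := con (+ 1) :* x) refl (1/ 0 !))
    (recip-inverseʳ (fromℕ 1) _)

  1/suc! : ∀ k → 1/ suc k ! ≈ 1/suc k * 1/ k !
  1/suc! k = *-cancelˡ-≈ 0<sk! (trans (recip-inverseʳ (fromℕ (suc k !)) 0<sk!) (sym (begin-equality
    fromℕ (suc k ℕ.* k !) * (1/suc k * 1/ k !)         ≈⟨ *-congʳ (fromℕ-* (suc k) (k !)) ⟩
    (fromℕ (suc k) * fromℕ (k !)) * (1/suc k * 1/ k !) ≈⟨ solve 4 (λ a b c d → (a :* b) :* (c :* d) := (a :* c) :* (b :* d))
                                                            refl (fromℕ (suc k)) (fromℕ (k !)) (1/suc k) (1/ k !) ⟩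
    (fromℕ (suc k) * 1/suc k) * (fromℕ (k !) * 1/ k !) ≈⟨ *-cong (recip-inverseʳ (fromℕ (suc k)) _) (recip-inverseʳ (fromℕ (k !)) _) ⟩
    1# * 1#                                            ≈⟨ *-identityˡ 1# ⟩
    1#                                                 ∎)))
    where
    open ≤-Reasoning
    0<sk! = fromℕ-positive (suc k !) {{suc k ℕ.!≢0}}

  re-termℂ-zero : ∀ w → re (termℂ w 0) ≈ 1#
  re-termℂ-zero w = trans (solve 1 (λ x → x :* :1 :- con 0ℤ :* con 0ℤ := x) refl (1/ 0 !)) 1/0!≈1

  im-termℂ-zero : ∀ w → im (termℂ w 0) ≈ 0#
  im-termℂ-zero w = solve 1 (λ x → x :* con 0ℤ :+ con 0ℤ :* :1 := con 0ℤ) refl (1/ 0 !)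

  re-termℂ-suc : ∀ w k → re (termℂ w (suc k)) ≈
                 (re w * re (termℂ w k) - im w * im (termℂ w k)) * 1/suc k
  re-termℂ-suc w k = trans (+-congʳ (*-congʳ (1/suc! k)))
    (solve 6 (λ i f a b c d → (i :* f) :* (a :* c :- b :* d) :- con 0ℤ :* (a :* d :+ b :* c)
        := (a :* (f :* c :- con 0ℤ :* d) :- b :* (f :* d :+ con 0ℤ :* c)) :* i)
      refl (1/suc k) (1/ k !) (re w) (im w) (re (w ℂᵣ.^ k)) (im (w ℂᵣ.^ k)))

  im-termℂ-suc : ∀ w k → im (termℂ w (suc k)) ≈
                 (re w * im (termℂ w k) + im w * re (termℂ w k)) * 1/suc k
  im-termℂ-suc w k = trans (+-congʳ (*-congʳ (1/suc! k)))
    (solve 6 (λ i f a b c d → (i :* f) :* (a :* d :+ b :* c) :+ con 0ℤ :* (a :* c :- b :* d)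
        := (a :* (f :* d :+ con 0ℤ :* c) :+ b :* (f :* c :- con 0ℤ :* d)) :* i)
      refl (1/suc k) (1/ k !) (re w) (im w) (re (w ℂᵣ.^ k)) (im (w ℂᵣ.^ k)))

  re-sum : ∀ (f : ℕ → ℂ) N → re (ℂᵣ.sum {N} (f ∘ toℕ)) ≡ Σ (re ∘ f) N
  re-sum f ℕ.zero  = ≡.refl
  re-sum f (suc N) = ≡.cong (λ s → re (f 0) + s) (re-sum (f ∘ suc) N)

  im-sum : ∀ (f : ℕ → ℂ) N → im (ℂᵣ.sum {N} (f ∘ toℕ)) ≡ Σ (im ∘ f) N
  im-sum f ℕ.zero  = ≡.refl
  im-sum f (suc N) = ≡.cong (λ s → im (f 0) + s) (im-sum (f ∘ suc) N)

  termℂ-ofReal : ∀ x k → re (termℂ (ofReal x) k) ≈ expTerm x k × im (termℂ (ofReal x) k) ≈ 0#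
  termℂ-ofReal x ℕ.zero = re-termℂ-zero (ofReal x) , im-termℂ-zero (ofReal x)
  termℂ-ofReal x (suc k) =
    let re≈ , im≈ = termℂ-ofReal x k in
    trans (re-termℂ-suc (ofReal x) k) (*-congʳ (trans (+-cong (*-congˡ re≈) (-‿cong (*-congˡ im≈)))
      (solve 2 (λ x t → x :* t :- con 0ℤ :* con 0ℤ := x :* t) refl x (expTerm x k)))) ,
    trans (im-termℂ-suc (ofReal x) k) (trans (*-congʳ (+-cong (*-congˡ im≈) (*-congˡ re≈)))
      (solve 3 (λ x t i → (x :* con 0ℤ :+ con 0ℤ :* t) :* i := con 0ℤ) refl x (expTerm x k) (1/suc k)))

  -- The logarithm and the number b enter the estimates only through this limit of real partial
  -- sums.
  IsRealExp⇒expΣ : ∀ {x y} → IsRealExp x y → expΣ x ⟶ y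
  IsRealExp⇒expΣ {x} (re-lim , _) = ⟶-cong (λ N → trans
    (reflexive (re-sum (termℂ (ofReal x)) N)) (Σ-cong (proj₁ ∘ termℂ-ofReal x) N)) re-lim

  -- Cosine and sine series: bounds, Lipschitz estimates and the points e^{iθ} for small θ.

  i*_ : Carrier → ℂ
  i* θ = 0# +i θ

  cosTerm sinTerm : Carrier → ℕ → Carrier
  cosTerm θ k = re (termℂ (i* θ) k)
  sinTerm θ k = im (termℂ (i* θ) k)

  cosTerm-suc : ∀ θ k → cosTerm θ (suc k) ≈ - (θ * sinTerm θ k) * 1/suc k
  cosTerm-suc θ k = trans (re-termℂ-suc (i* θ) k) (*-congʳ
    (solve 2 (λ x y → con 0ℤ :* x :- y := :- y) refl (cosTerm θ k) (θ * sinTerm θ k)))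

  sinTerm-suc : ∀ θ k → sinTerm θ (suc k) ≈ (θ * cosTerm θ k) * 1/suc k
  sinTerm-suc θ k = trans (im-termℂ-suc (i* θ) k) (*-congʳ
    (solve 2 (λ x y → con 0ℤ :* x :+ y := y) refl (sinTerm θ k) (θ * cosTerm θ k)))

  ∣trigTerm∣≤ : ∀ {θ a} → ∣ θ ∣≤ a → ∀ k → ∣ cosTerm θ k ∣≤ expTerm a k × ∣ sinTerm θ k ∣≤ expTerm a k
  ∣trigTerm∣≤ {θ} ∣θ∣≤a ℕ.zero =
    ∣∣≤-cong (sym (re-termℂ-zero (i* θ))) refl (∣x∣≤x 0≤1) ,
    ∣∣≤-cong (sym (im-termℂ-zero (i* θ))) refl (∣∣≤-weaken 0≤1 (∣x∣≤x ≤-refl))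
  ∣trigTerm∣≤ {θ} ∣θ∣≤a (suc k) =
    let ∣cos∣≤ , ∣sin∣≤ = ∣trigTerm∣≤ ∣θ∣≤a k in
    ∣∣≤-cong (sym (cosTerm-suc θ k)) refl (∣∣≤-* (∣∣≤-neg (∣∣≤-* ∣θ∣≤a ∣sin∣≤)) (∣x∣≤x (0≤1/suc k))) ,
    ∣∣≤-cong (sym (sinTerm-suc θ k)) refl (∣∣≤-* (∣∣≤-* ∣θ∣≤a ∣cos∣≤) (∣x∣≤x (0≤1/suc k)))

  -- δ a^{k-1} / (k-1)!, that is δ times the bound for the derivative of θ^k / k!. The term of
  -- degree 0 is constant, whence the 0.
  trigTermLipschitz : Carrier → Carrier → ℕ → Carrier
  trigTermLipschitz a δ ℕ.zero  = 0#
  trigTermLipschitz a δ (suc k) = δ * expTerm a k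

  -- a^k / (k-1)! is k copies of a^k / k!, and the second summand is one more.
  trigTermLipschitz-suc : ∀ a δ k →
    (a * trigTermLipschitz a δ k + δ * expTerm a k) * 1/suc k ≈ δ * expTerm a k
  trigTermLipschitz-suc a δ k = trans (*-congʳ (count k))
    (trans (solve 3 (λ n d i → (n :* d) :* i := (n :* i) :* d)
             refl (fromℕ (suc k)) (δ * expTerm a k) (1/suc k))
      (trans (*-congʳ (recip-inverseʳ (fromℕ (suc k)) (fromℕ-positive (suc k)))) (*-identityˡ _)))
    where
    count : ∀ k → a * trigTermLipschitz a δ k + δ * expTerm a k ≈ fromℕ (suc k) * (δ * expTerm a k)
    count ℕ.zero = solve 2 (λ a δ → a :* con 0ℤ :+ δ :* :1 := con (+ 1) :* (δ :* :1)) refl a δ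
    count (suc k) = trans
      (+-congʳ (trans (solve 3 (λ a δ t → a :* (δ :* t) := δ :* (a :* t)) refl a δ (expTerm a k))
        (*-congˡ (sym (derivative-term a k)))))
      (solve 3 (λ δ n t → δ :* (n :* t) :+ δ :* t := (:1 :+ n) :* (δ :* t))
        refl δ (fromℕ (suc k)) (expTerm a (suc k)))

  module _ {θ φ a δ} (∣θ∣≤a : ∣ θ ∣≤ a) (∣φ∣≤a : ∣ φ ∣≤ a) (∣θ-φ∣≤δ : ∣ θ - φ ∣≤ δ) where

    private
      -- Cosine and sine terms produce each other, hence the arbitrary x and y; the splitting is θ x
      -- - φ y = θ (x - y) + (θ - φ) y.
      step : ∀ k {x y} → ∣ x - y ∣≤ trigTermLipschitz a δ k → ∣ y ∣≤ expTerm a k →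
             ∣ (θ * x) * 1/suc k - (φ * y) * 1/suc k ∣≤ δ * expTerm a k
      step k {x} {y} p q = ∣∣≤-cong
        (solve 5 (λ θ φ x y i → (θ :* (x :- y) :+ (θ :- φ) :* y) :* i := (θ :* x) :* i :- (φ :* y) :* i)
          refl θ φ x y (1/suc k))
        (trigTermLipschitz-suc a δ k)
        (∣∣≤-* (∣∣≤-+ (∣∣≤-* ∣θ∣≤a p) (∣∣≤-* ∣θ-φ∣≤δ q)) (∣x∣≤x (0≤1/suc k)))

    trigTerm-lipschitz : ∀ k → ∣ cosTerm θ k - cosTerm φ k ∣≤ trigTermLipschitz a δ k
                             × ∣ sinTerm θ k - sinTerm φ k ∣≤ trigTermLipschitz a δ k
    trigTerm-lipschitz ℕ.zero =
      ∣∣≤-cong (sym (-‿inverseʳ _)) refl (∣x∣≤x ≤-refl) , ∣∣≤-cong (sym (-‿inverseʳ _)) refl (∣x∣≤x ≤-refl)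
    trigTerm-lipschitz (suc k) =
      let cos-lip , sin-lip = trigTerm-lipschitz k
          ∣cos∣≤ , ∣sin∣≤ = ∣trigTerm∣≤ ∣φ∣≤a k
      in
      ∣∣≤-cong
        (trans (solve 3 (λ x y i → :- (x :* i :- y :* i) := (:- x) :* i :- (:- y) :* i)
                 refl (θ * sinTerm θ k) (φ * sinTerm φ k) (1/suc k))
          (+-cong (sym (cosTerm-suc θ k)) (-‿cong (sym (cosTerm-suc φ k)))))
        refl (∣∣≤-neg (step k sin-lip ∣sin∣≤)) ,
      ∣∣≤-cong (+-cong (sym (sinTerm-suc θ k)) (-‿cong (sym (sinTerm-suc φ k))))
        refl (step k cos-lip ∣cos∣≤)

  -- For 2a ≤ 1 the terms halve from the start, so the tail bound holds from degree 0 on and the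
  -- partial sums stay within 2.
  module SmallAngles {a} (0≤a : 0# ≤ a) (2a≤1 : a + a ≤ 1#) where

    open TermEnvelope 0≤a 0 (≤-trans 2a≤1 (≤-reflexive (sym (+-identityʳ 1#))))

    private
      module Partial (f : ℕ → Carrier) (∣f∣≤ : ∀ k → ∣ f k ∣≤ expTerm a k) where
        open Envelope (Σ f) bound 0 0≤bound
          (λ n 0≤n → ∣∣≤-term⇒step {k = n} 0≤n (∣∣≤-cong (sym (Σ-last f n)) refl (∣f∣≤ n))) public

        limit : ∃[ x ] Σ f ⟶ x
        limit = complete (Σ f) (cauchy bound-null)

        ∣limit∣≤2 : ∣ proj₁ limit ∣≤ fromℕ 2
        ∣limit∣≤2 = ∣∣≤-cong (solve 1 (λ x → x :- con 0ℤ := x) refl (proj₁ limit))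
          (+-congˡ (sym (+-identityʳ 1#)))
          (limit-∣∣≤ (proj₂ limit) 0 (λ n _ → difference {0} {n} ℕ.z≤n ℕ.z≤n))

    module Cis {θ} (∣θ∣≤a : ∣ θ ∣≤ a) where

      private
        module Cos = Partial (cosTerm θ) (proj₁ ∘ ∣trigTerm∣≤ ∣θ∣≤a)
        module Sin = Partial (sinTerm θ) (proj₂ ∘ ∣trigTerm∣≤ ∣θ∣≤a)

      cis : ℂ
      cis = proj₁ Cos.limit +i proj₁ Sin.limit

      isCis : IsCis θ cis
      isCis =
        ⟶-cong (λ N → reflexive (≡.sym (re-sum (termℂ (i* θ)) N))) (proj₂ Cos.limit) ,
        ⟶-cong (λ N → reflexive (≡.sym (im-sum (termℂ (i* θ)) N))) (proj₂ Sin.limit)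

      sin-limit : Σ (sinTerm θ) ⟶ im cis
      sin-limit = proj₂ Sin.limit

      -- The true value is 1, but 8 = 2² + 2² comes directly from the bound on partial sums and
      -- affects only constants.
      normSq-cis : normSq cis ≤ fromℕ 8
      normSq-cis = ≤-trans (+-mono-≤ (∣∣≤⇒²≤ Cos.∣limit∣≤2) (∣∣≤⇒²≤ Sin.∣limit∣≤2))
        (≤-reflexive (solve 0 (con (+ 2) :* con (+ 2) :+ con (+ 2) :* con (+ 2) := con (+ 8)) refl))

    open Cis public

    module _ {θ φ δ} (∣θ∣≤a : ∣ θ ∣≤ a) (∣φ∣≤a : ∣ φ ∣≤ a) (∣θ-φ∣≤δ : ∣ θ - φ ∣≤ δ) where

      private
        0≤δ : 0# ≤ δ
        0≤δ = 0≤-half (≤-trans (x≤y⇒0≤y-x (≤-trans (proj₁ ∣θ-φ∣≤δ) (proj₂ ∣θ-φ∣≤δ)))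
          (≤-reflexive (solve 1 (λ δ → δ :- (:- δ) := δ :+ δ) refl δ)))

        u e : ℕ → Carrier
        u n = Σ (sinTerm θ) n - Σ (sinTerm φ) n
        -- A filler: the envelope is used from index 2 on. The shift by one matches the Lipschitz
        -- bound in degree k, which involves the exponential term of degree k - 1.
        e ℕ.zero  = 0#
        e (suc n) = δ * bound n

        0≤e : ∀ n → 0# ≤ e n
        0≤e ℕ.zero  = ≤-refl
        0≤e (suc n) = 0≤x*y 0≤δ (0≤bound n)

        u-step : ∀ n → 2 ℕ.≤ n → ∣ u (suc n) - u n ∣≤ e n - e (suc n)
        u-step (suc n) _ = ∣∣≤-cong
          (trans (+-cong (sym (Σ-last (sinTerm θ) (suc n))) (-‿cong (sym (Σ-last (sinTerm φ) (suc n)))))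
            (solve 4 (λ x y z w → (x :- y) :- (z :- w) := (x :- z) :- (y :- w)) refl _ _ _ _))
          refl
          (∣∣≤-weaken (≤-by-difference
              (0≤x*y 0≤δ (x≤y⇒0≤y-x (proj₂ (∣∣≤-term⇒step {k = n} ℕ.z≤n (∣x∣≤x (0≤term 0≤a n))))))
              (solve 4 (λ δ t b c → (δ :* b :- δ :* c) :- δ :* t := δ :* ((b :- c) :- t))
                refl δ (expTerm a n) (bound n) (bound (suc n))))
            (proj₂ (trigTerm-lipschitz ∣θ∣≤a ∣φ∣≤a ∣θ-φ∣≤δ (suc n))))

        Σsin₂ : ∀ ψ → Σ (sinTerm ψ) 2 ≈ ψ
        Σsin₂ ψ = trans (+-cong (im-termℂ-zero (i* ψ)) (+-congʳ (trans (sinTerm-suc ψ 0)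
            (trans (*-congʳ (*-congˡ (re-termℂ-zero (i* ψ)))) (term-one ψ)))))
          (solve 1 (λ ψ → con 0ℤ :+ (ψ :+ con 0ℤ) := ψ) refl ψ)

      -- The partial sums through degree 1 are θ and φ themselves. In the tail the Lipschitz
      -- constants a^{k-1} / (k-1)!, k ≥ 2, add up to at most 2a. This takes the place of the mean
      -- value theorem.
      sin-difference : ∣ (im (cis ∣θ∣≤a) - im (cis ∣φ∣≤a)) - (θ - φ) ∣≤ δ * (a + a)
      sin-difference = limit-∣∣≤ (⟶-sub (sin-limit ∣θ∣≤a) (sin-limit ∣φ∣≤a)) 2
        (λ n 2≤n → ∣∣≤-cong (+-congˡ (-‿cong (+-cong (Σsin₂ θ) (-‿cong (Σsin₂ φ)))))
          (*-congˡ (+-cong (term-one a) (term-one a))) (Envelope.difference u e 2 0≤e u-step ℕ.≤-refl 2≤n))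

  -- Interpolation

  -- The Horner values h_i at w of the tails of f are f(w) and the coefficients of the quotient, and
  -- f_i = h_i - w h_{i+1}. With |w|² ≤ 8 this gives 2 (β + 8 β) = 18 β.
  coefficient-≤ : ∀ {n} (f : Fin (suc n) → ℂ) w β → normSq w ≤ fromℕ 8 →
    normSq (horner f w) ≤ β → (∀ i → normSq (quotient f w i) ≤ β) →
    ∀ i → normSq (f i) ≤ fromℕ 18 * β
  coefficient-≤ {ℕ.zero} f w β _ f[w]≤β _ zero = ≤-trans
    (≤-trans (≤-reflexive (normSq-cong (ℂᶜ.sym (x+y*0≈x (f zero) w))))
      f[w]≤β)
    (≤-by-difference (0≤x*y (0≤fromℕ 17) (≤-trans (0≤normSq (horner f w)) f[w]≤β))
      (solve 1 (λ β → con (+ 18) :* β :- β := con (+ 17) :* β) refl β))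
  coefficient-≤ {suc n} f w β w≤8 f[w]≤β q≤β zero = begin
    normSq (f zero)                       ≈⟨ normSq-cong ([x+y]-y≈x (f zero) (w ℂᵣ.* g)) ⟨
    normSq (horner f w ℂᵣ.+ ℂᵣ.- (w ℂᵣ.* g)) ≤⟨ normSq-+ (horner f w) (ℂᵣ.- (w ℂᵣ.* g)) ⟩
    fromℕ 2 * (normSq (horner f w) + normSq (ℂᵣ.- (w ℂᵣ.* g)))
      ≤⟨ *-monoʳ-≤ (0≤fromℕ 2) (+-mono-≤ f[w]≤β (≤-trans
           (≤-reflexive (trans (normSq-neg (w ℂᵣ.* g)) (normSq-* w g)))
           (*-mono-≤ (0≤normSq w) (≤-trans (0≤normSq g) (q≤β zero)) w≤8 (q≤β zero)))) ⟩
    fromℕ 2 * (β + fromℕ 8 * β)           ≈⟨ solve 1 (λ β → con (+ 2) :* (β :+ con (+ 8) :* β) := con (+ 18) :* β) refl β ⟩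
    fromℕ 18 * β                          ∎
    where
    open ≤-Reasoning
    g = horner (f ∘ suc) w
  coefficient-≤ {suc n} f w β w≤8 f[w]≤β q≤β (suc i) =
    coefficient-≤ (f ∘ suc) w β w≤8 (q≤β zero) (q≤β ∘ suc) i

  choose : ∀ {n p q} {P : Fin n → Set p} {Q : Fin n → Set q} →
           (∀ i → P i ⊎ Q i) → (∃[ i ] P i) ⊎ (∀ i → Q i)
  choose {ℕ.zero} P⊎Q = inj₂ λ ()
  choose {suc n} P⊎Q = [ (λ p → inj₁ (zero , p)) , (λ q → [ (λ (i , p) → inj₁ (suc i , p)) ,
    (λ qs → inj₂ λ { zero → q ; (suc i) → qs i }) ]′ (choose (P⊎Q ∘ suc))) ]′ (P⊎Q zero)

  sumOver-cong : ∀ {n} d {f g : Vec (Fin n) d → ℂ} → (∀ k → f k ℂᵣ.≈ g k) → sumOver d f ℂᵣ.≈ sumOver d g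
  sumOver-cong ℕ.zero  f≈g = f≈g []
  sumOver-cong {n} (suc d) f≈g = ℂ-Sum.sum-cong-≋ {n} (λ i → sumOver-cong d (λ k → f≈g (i ∷ k)))

  *-distribˡ-sumOver : ∀ {n} d x (f : Vec (Fin n) d → ℂ) →
                       x ℂᵣ.* sumOver d f ℂᵣ.≈ sumOver d (λ k → x ℂᵣ.* f k)
  *-distribˡ-sumOver ℕ.zero x f = ℂᶜ.refl
  *-distribˡ-sumOver {n} (suc d) x f = ℂᶜ.trans (ℂ-Sum.*-distribˡ-sum {n} x _)
    (ℂ-Sum.sum-cong-≋ {n} (λ i → *-distribˡ-sumOver d x (λ k → f (i ∷ k))))

  -- Singles out the first variable, which makes induction on the number of variables possible.
  evaluate-suc : ∀ {n d} (a : Vec (Fin n) (suc d) → ℤ) z →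
    evaluate a z ℂᵣ.≈ horner (λ i → evaluate (λ k → a (i ∷ k)) (z ∘ suc)) (z zero)
  evaluate-suc {n} {d} a z = ℂᶜ.trans
    (ℂ-Sum.sum-cong-≋ {n} (λ i → ℂᶜ.trans
      (sumOver-cong d (λ k → x*[y*z]≈y*[x*z] (ofℤ (a (i ∷ k))) (z zero ℂᵣ.^ toℕ i) (monomial k (z ∘ suc))))
      (ℂᶜ.sym (*-distribˡ-sumOver d (z zero ℂᵣ.^ toℕ i) (λ k → ofℤ (a (i ∷ k)) ℂᵣ.* monomial k (z ∘ suc))))))
    (sum≈horner (λ i → evaluate (λ k → a (i ∷ k)) (z ∘ suc)) (z zero))

  module SeparatedPoints {S} (1≤S : 1# ≤ S) where

    private
      0≤S = ≤-trans 0≤1 1≤S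
      -- The loss per division: 18 from `coefficient-≤`, 4 from |f(x) - f(w)|² ≤ 2 (V + V), and S
      -- from dividing by x - w.
      A = fromℕ 72 * S
      1≤A : 1# ≤ A
      1≤A = 1≤x*y (≤-trans (≤-reflexive (sym (+-identityʳ 1#))) (fromℕ-mono-≤ {1} {72} (ℕ.s≤s ℕ.z≤n))) 1≤S

    Bounded Separated : ∀ {n} → (Fin n → ℂ) → Set _
    Bounded z = ∀ i → normSq (z i) ≤ fromℕ 8
    Separated z = ∀ i j → i ≢ j → 1# ≤ S * normSq (z i ℂᵣ.+ ℂᵣ.- z j)

    coefficients-≤ : ∀ {n} (f z : Fin n → ℂ) → Bounded z → Separated z → ∀ {V} →
      (∀ j → normSq (horner f (z j)) ≤ V) → ∀ i → normSq (f i) ≤ A ^ n * V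
    coefficients-≤ {suc n} f z bounded separated {V} f[z]≤V i = ≤-trans
      (coefficient-≤ f w β (bounded zero) f[w]≤β
        (coefficients-≤ (quotient f w) (z ∘ suc) (bounded ∘ suc)
          (λ i j i≢j → separated (suc i) (suc j) (i≢j ∘ Fin.suc-injective)) q≤) i)
      (≤-reflexive (solve 3 (λ p S V → con (+ 18) :* (p :* (S :* (con (+ 4) :* V)))
                                    := ((con (+ 72) :* S) :* p) :* V) refl (A ^ n) S V))
      where
      open ≤-Reasoning
      w = z zero
      β = A ^ n * (S * (fromℕ 4 * V))
      0≤V = ≤-trans (0≤normSq _) (f[z]≤V zero)
      0≤4V = 0≤x*y (0≤fromℕ 4) 0≤V

      f[w]≤β : normSq (horner f w) ≤ β
      f[w]≤β = begin
        normSq (horner f w)          ≤⟨ f[z]≤V zero ⟩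
        V                            ≤⟨ ≤-by-difference (0≤x*y (0≤fromℕ 3) 0≤V)
                                          (solve 1 (λ V → con (+ 4) :* V :- V := con (+ 3) :* V) refl V) ⟩
        fromℕ 4 * V                  ≈⟨ *-identityˡ _ ⟨
        1# * (fromℕ 4 * V)           ≤⟨ *-monoˡ-≤ 0≤4V (1≤x*y (1≤x^n n 1≤A) 1≤S) ⟩
        (A ^ n * S) * (fromℕ 4 * V)  ≈⟨ *-assoc _ _ _ ⟩
        β                            ∎

      q≤ : ∀ j → normSq (horner (quotient f w) (z (suc j))) ≤ S * (fromℕ 4 * V)
      q≤ j = begin
        normSq q                                          ≈⟨ *-identityˡ _ ⟨
        1# * normSq q                                     ≤⟨ *-monoˡ-≤ (0≤normSq q) (separated (suc j) zero λ ()) ⟩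
        (S * normSq (x ℂᵣ.+ ℂᵣ.- w)) * normSq q           ≈⟨ *-assoc _ _ _ ⟩
        S * (normSq (x ℂᵣ.+ ℂᵣ.- w) * normSq q)           ≈⟨ *-congˡ (normSq-* (x ℂᵣ.+ ℂᵣ.- w) q) ⟨
        S * normSq ((x ℂᵣ.+ ℂᵣ.- w) ℂᵣ.* q)               ≈⟨ *-congˡ (normSq-cong (quotient-correct f w x)) ⟩
        S * normSq (horner f x ℂᵣ.+ ℂᵣ.- horner f w)      ≤⟨ *-monoʳ-≤ 0≤S (normSq-+ _ _) ⟩
        S * (fromℕ 2 * (normSq (horner f x) + normSq (ℂᵣ.- horner f w)))
          ≤⟨ *-monoʳ-≤ 0≤S (*-monoʳ-≤ (0≤fromℕ 2) (+-mono-≤ (f[z]≤V (suc j))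
               (≤-trans (≤-reflexive (normSq-neg (horner f w))) (f[z]≤V zero)))) ⟩
        S * (fromℕ 2 * (V + V))  ≈⟨ *-congˡ (solve 1 (λ V → con (+ 2) :* (V :+ V) := con (+ 4) :* V) refl V) ⟩
        S * (fromℕ 4 * V)        ∎
        where
        x = z (suc j)
        q = horner (quotient f w) x

    -- The values are tested against V and 2V. If all were below 2V, every coefficient would be at
    -- most 2 A^n V in squared modulus; the factor 4 makes the contradiction strict.
    loss : ℕ → Carrier
    loss n = fromℕ 4 * A ^ n

    large-value : ∀ {n} (f z : Fin n → ℂ) → Bounded z → Separated z → ∀ {V} → 0# < V →
      ∀ i → loss n * V ≤ normSq (f i) → ∃[ j ] V < normSq (horner f (z j))
    large-value {n} f z bounded separated {V} 0<V i large =
      [ (λ found → found) , (λ small → ⊥-elim (contradiction small)) ]′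
        (choose λ j → <-cotrans (<-by-difference 0<V (solve 1 (λ V → (V :+ V) :- V := V) refl V))
          (normSq (horner f (z j))))
      where
      contradiction : (∀ j → normSq (horner f (z j)) < V + V) → _
      contradiction small = ≤-trans large (coefficients-≤ f z bounded separated (<⇒≤ ∘ small) i)
        (<-by-difference (*-positive (*-positive (fromℕ-positive 2) (0<x^n n (1≤x⇒0<x 1≤A))) 0<V)
          (solve 2 (λ p V → (con (+ 4) :* p) :* V :- p :* (V :+ V) := (con (+ 2) :* p) :* V) refl (A ^ n) V))

    -- The later variables are fixed first, so that the coefficient with index i of the remaining
    -- one-variable polynomial is already large when `large-value` picks the first variable.
    large-evaluation : ∀ {n} (z : Fin n → ℂ) → Bounded z → Separated z → ∀ {d} (a : Vec (Fin n) d → ℤ) {V} →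
      0# < V → ∀ k → loss n ^ d * V ≤ normSq (ofℤ (a k)) →
      ∃[ σ ] V ≤ normSq (evaluate a (z ∘ σ))
    large-evaluation z bounded separated {ℕ.zero} a {V} 0<V [] large = (λ ()) , (begin
      V                              ≈⟨ *-identityˡ V ⟨
      1# * V                         ≤⟨ large ⟩
      normSq (ofℤ (a []))            ≈⟨ normSq-cong (ℂᶜ.*-identityʳ (ofℤ (a []))) ⟨
      normSq (ofℤ (a []) ℂᵣ.* ℂᵣ.1#) ∎)
      where open ≤-Reasoning
    large-evaluation {n} z bounded separated {suc d} a {V} 0<V (i ∷ k) large =
      extend (large-evaluation z bounded separated (slice i) (*-positive 0<loss 0<V) k
        (≤-trans (≤-reflexive (solve 3 (λ q p V → p :* (q :* V) := (q :* p) :* V) refl (loss n) (loss n ^ d) V)) large))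
      where
      0<loss : 0# < loss n
      0<loss = *-positive (fromℕ-positive 4) (0<x^n n (1≤x⇒0<x 1≤A))

      slice : Fin n → Vec (Fin n) d → ℤ
      slice i k = a (i ∷ k)

      extend : (∃[ σ ] loss n * V ≤ normSq (evaluate (slice i) (z ∘ σ))) →
               ∃[ σ ] V ≤ normSq (evaluate a (z ∘ σ))
      extend (σ , large′) = choose-first (large-value f z bounded separated 0<V i large′)
        where
        f : Fin n → ℂ
        f i = evaluate (slice i) (z ∘ σ)

        choose-first : (∃[ j ] V < normSq (horner f (z j))) → ∃[ σ ] V ≤ normSq (evaluate a (z ∘ σ))
        choose-first (j , V<) = j Functional.∷ σ , ≤-trans (<⇒≤ V<)
          (≤-reflexive (sym (normSq-cong {evaluate a (z ∘ (j Functional.∷ σ))} {horner f (z j)}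
            (evaluate-suc a (z ∘ (j Functional.∷ σ))))))

  normSq-±1 : ∀ i → i ≡ 1ℤ ⊎ i ≡ -1ℤ → normSq (ofℤ i) ≈ 1#
  normSq-±1 _ (inj₁ ≡.refl) = solve 0
    ((:1 :+ con 0ℤ) :* (:1 :+ con 0ℤ) :+ (con 0ℤ :+ con 0ℤ) :* (con 0ℤ :+ con 0ℤ) := :1) refl
  normSq-±1 _ (inj₂ ≡.refl) = solve 0
    ((:- (:1 :+ con 0ℤ)) :* (:- (:1 :+ con 0ℤ)) :+ (:- (con 0ℤ :+ con 0ℤ)) :* (:- (con 0ℤ :+ con 0ℤ)) := :1) refl

  term-cong : ∀ {x y} → x ≈ y → ∀ k → expTerm x k ≈ expTerm y k
  term-cong x≈y ℕ.zero  = refl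
  term-cong x≈y (suc k) = *-congʳ (*-cong x≈y (term-cong x≈y k))

  expΣ₂ : ∀ x → expΣ x 2 ≈ 1# + x
  expΣ₂ x = +-congˡ (trans (+-identityʳ _) (term-one x))

  -- Logarithms

  -- If x < 0, the first two terms of the series at -x give y (1 - x) ≤ 1, which is impossible for y
  -- ≥ 1.
  1≤exp⇒0≤ : ∀ {x y} → expΣ x ⟶ y → 1# ≤ y → 0# ≤ x
  1≤exp⇒0≤ {x} {y} lim 1≤y x<0 = ≤-trans
    (≤-trans (*-monoˡ-≤ (<⇒≤ 0<1-x) 1≤y) (≤-reflexive (*-congˡ (sym (expΣ₂ (- x))))))
    (ExpNegation.limit-*-expΣ≤1 (<⇒≤ 0<-x)
      (⟶-cong (λ N → Σ-cong (term-cong (solve 1 (λ x → x := :- (:- x)) refl x)) N) lim) 2)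
    (<-by-difference 0<-x (solve 1 (λ x → :1 :* (:1 :- x) :- :1 := :- x) refl x))
    where
    0<-x : 0# < - x
    0<-x = <-by-difference (x<y⇒0<y-x x<0) (solve 1 (λ x → (:- x) :- con 0ℤ := con 0ℤ :- x) refl x)
    0<1-x = 0<x+y 0<1 (<⇒≤ 0<-x)

  -- If 2x < 1, the terms halve from the start, so y - 1 is at most twice the first term x, and y ≤
  -- 1 + 2x < 2.
  2≤exp⇒1≤2x : ∀ {x y} → expΣ x ⟶ y → fromℕ 2 ≤ y → 1# ≤ x + x
  2≤exp⇒1≤2x {x} {y} lim 2≤y 2x<1 = ≤-trans 2≤y
    (≤-trans (≤-reflexive (solve 1 (λ y → y := (y :- (:1 :+ con 0ℤ)) :+ :1) refl y))
      (+-monoˡ-≤ 1# (≤-trans (proj₂ (limit-∣∣≤ lim 1 (λ n 1≤n → difference ℕ.z≤n 1≤n)))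
        (≤-reflexive (+-cong (term-one x) (term-one x))))))
    (<-by-difference (x<y⇒0<y-x 2x<1) (solve 1 (λ x → con (+ 2) :- ((x :+ x) :+ :1) := :1 :- (x :+ x)) refl x))
    where
    0≤x : 0# ≤ x
    0≤x = 1≤exp⇒0≤ lim (≤-trans (≤-by-difference 0≤1 (solve 0 (con (+ 2) :- :1 := :1) refl)) 2≤y)

    open TermEnvelope 0≤x 0 (≤-trans (<⇒≤ 2x<1) (≤-reflexive (sym (+-identityʳ 1#))))
    open Envelope (expΣ x) bound 0 0≤bound
      (λ n 0≤n → ∣∣≤-term⇒step {k = n} 0≤n (∣∣≤-cong (sym (Σ-last (expTerm x) n)) refl (∣x∣≤x (0≤term 0≤x n))))

  -- Reaches x y expresses y ≤ exp x through a partial sum of the exponential series.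
  Reaches : Carrier → Carrier → Set _
  Reaches x y = ∃[ N ] y ≤ expΣ x N

  reaches-mono : ∀ {x x′ y} → 0# ≤ x → x ≤ x′ → Reaches x y → Reaches x′ y
  reaches-mono 0≤x x≤x′ (N , y≤) = N , ≤-trans y≤ (expΣ-mono-≤ 0≤x x≤x′ N)

  reaches-* : ∀ {x x′ y y′} → 0# ≤ x → 0# ≤ x′ → 0# ≤ y → Reaches x y → Reaches x′ y′ → Reaches (x + x′) (y * y′)
  reaches-* 0≤x 0≤x′ 0≤y (M , y≤) (N , y′≤) = M ℕ.+ N , ≤-trans
    (*-mono-≤ 0≤y (0≤Σ (0≤term 0≤x′) N) y≤ y′≤) (expΣ-* 0≤x 0≤x′ M N)

  reaches-^ : ∀ {x y} → 0# ≤ x → 0# ≤ y → Reaches x y → ∀ k → Reaches (fromℕ k * x) (y ^ k)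
  reaches-^ 0≤x 0≤y reaches ℕ.zero = 1 , ≤-reflexive (sym (+-identityʳ 1#))
  reaches-^ {x} 0≤x 0≤y reaches (suc k) = reaches-mono
    (0≤x+y 0≤x 0≤kx)
    (≤-reflexive (solve 2 (λ k x → x :+ k :* x := (:1 :+ k) :* x) refl (fromℕ k) x))
    (reaches-* 0≤x 0≤kx 0≤y reaches (reaches-^ 0≤x 0≤y reaches k))
    where 0≤kx = 0≤x*y (0≤fromℕ k) 0≤x

  reaches-≤ : ∀ {x y} → 0# ≤ y → y ≤ x → Reaches x y
  reaches-≤ {x} {y} 0≤y y≤x = reaches-mono 0≤y y≤x (2 , ≤-trans
    (≤-by-difference 0≤1 (solve 1 (λ y → (:1 :+ y) :- y := :1) refl y)) (≤-reflexive (sym (expΣ₂ y))))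

  -- Partial sums at x may stay below their limit y, so the exponent is doubled: some partial sum is
  -- at least y - 1/2, and (y - 1/2)² ≥ y because y ≥ 2.
  reaches-limit : ∀ {x y} → expΣ x ⟶ y → fromℕ 2 ≤ y → 0# ≤ x → Reaches (x + x) y
  reaches-limit {x} {y} lim 2≤y 0≤x = N ℕ.+ N , (begin
    y                      ≤⟨ ≤-by-difference
                                (0≤x+y (0≤x*y (≤-trans (0≤fromℕ 2) 2≤y) (x≤y⇒0≤y-x 2≤y)) (0≤x² half))
                                (trans (solve 2 (λ y h → (y :- h) :* (y :- h) :- y
                                           := (y :* y :- y :* (h :* :1 :+ h :* :1) :- y) :+ h :* h) refl y half)
                                  (trans (+-congʳ (+-congʳ (+-congˡ (-‿cong (*-congˡ (halves 1#))))))
                                    (solve 2 (λ y h → (y :* y :- y :* :1 :- y) :+ h :* h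
                                                   := y :* (y :- con (+ 2)) :+ h :* h) refl y half))) ⟩
    (y - half) * (y - half) ≤⟨ *-mono-≤ 0≤y-half (≤-trans 0≤y-half y-half≤p) y-half≤p y-half≤p ⟩
    expΣ x N * expΣ x N    ≤⟨ expΣ-* 0≤x 0≤x N N ⟩
    expΣ (x + x) (N ℕ.+ N) ∎)
    where
    open ≤-Reasoning
    N = proj₁ (lim half half-positive)

    y-half≤p : y - half ≤ expΣ x N
    y-half≤p = ≤-by-difference (<⇒≤ (x<y⇒0<y-x (proj₂ (proj₂ (lim half half-positive) N ℕ.≤-refl))))
      (solve 3 (λ p y h → p :- (y :- h) := (p :+ h) :- y) refl (expΣ x N) y half)

    0≤y-half : 0# ≤ y - half
    0≤y-half = ≤-trans
      (0≤x+y (x≤y⇒0≤y-x 2≤y) (0≤x+y 0≤1 (<⇒≤ half-positive)))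
      (≤-reflexive (trans (+-congˡ (+-congʳ (sym (halves 1#))))
        (trans (solve 2 (λ y h → (y :- con (+ 2)) :+ ((h :* :1 :+ h :* :1) :+ h)
                      := ((y :- con (+ 2)) :+ (h :* :1 :+ h :* :1) :+ (h :* :1 :+ h :* :1)) :- h) refl y half)
          (trans (+-congʳ (+-cong (+-congˡ (halves 1#)) (halves 1#)))
            (solve 2 (λ y h → ((y :- con (+ 2)) :+ :1 :+ :1) :- h := y :- h) refl y half)))))

  -- The points e^{iθ}, θ = jκ/(nL) for j < n, of the arc γ(L).
  module Grid {π m} (1<mπ : 1# < fromℕ m * π) (4≤m : 4 ℕ.≤ m) (n : ℕ) {L} (1≤L : 1# ≤ L) where

    private
      0<L = 1≤x⇒0<x 1≤L
      0<m : 0# < fromℕ m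
      0<m = <-≤-trans (fromℕ-positive 4) (fromℕ-mono-≤ 4≤m)
      u = 1/suc n
      w = recip L 0<L
      -- m π > 1 puts κ below π, which keeps the angles on the arc; m ≥ 4 puts it below 1/4, so that
      -- differences of sines are at least half the differences of angles.
      κ = recip (fromℕ m) 0<m
      δ = u * (κ * w)
      0≤u = 0≤1/suc n
      0<w = recip-positive L 0<L
      0<κ = recip-positive (fromℕ m) 0<m
      0≤κ = <⇒≤ 0<κ
      0≤κw = <⇒≤ (*-positive 0<κ 0<w)
      0<δ = *-positive (recip-positive (fromℕ (suc n)) (fromℕ-positive (suc n))) (*-positive 0<κ 0<w)

      4κ≤1 : fromℕ 4 * κ ≤ 1#
      4κ≤1 = ≤-trans (*-monoˡ-≤ 0≤κ (fromℕ-mono-≤ 4≤m)) (≤-reflexive (recip-inverseʳ (fromℕ m) 0<m))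

      2κ≤1 : κ + κ ≤ 1#
      2κ≤1 = ≤-trans (≤-by-difference (0≤x+y 0≤κ 0≤κ)
        (solve 1 (λ κ → con (+ 4) :* κ :- (κ :+ κ) := κ :+ κ) refl κ)) 4κ≤1

      κ≤π : κ ≤ π
      κ≤π = *-cancelˡ-≤ 0<m (≤-trans (≤-reflexive (recip-inverseʳ (fromℕ m) 0<m)) (<⇒≤ 1<mπ))

      w≤1 : w ≤ 1#
      w≤1 = ≤-trans (≤-reflexive (sym (*-identityˡ w)))
        (≤-trans (*-monoˡ-≤ (<⇒≤ 0<w) 1≤L) (≤-reflexive (recip-inverseʳ L 0<L)))

    angle : Fin (suc n) → Carrier
    angle j = fromℕ (toℕ j) * δ

    private
      0≤angle : ∀ j → 0# ≤ angle j
      0≤angle j = 0≤x*y (0≤fromℕ (toℕ j)) (<⇒≤ 0<δ)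

      angle≤κw : ∀ j → angle j ≤ κ * w
      angle≤κw j = begin
        fromℕ (toℕ j) * (u * (κ * w))  ≤⟨ *-monoˡ-≤ (<⇒≤ 0<δ) (fromℕ-mono-≤ (ℕ.<⇒≤ (Fin.toℕ<n j))) ⟩
        fromℕ (suc n) * (u * (κ * w))  ≈⟨ *-assoc _ _ _ ⟨
        (fromℕ (suc n) * u) * (κ * w)  ≈⟨ *-congʳ (recip-inverseʳ (fromℕ (suc n)) (fromℕ-positive (suc n))) ⟩
        1# * (κ * w)                   ≈⟨ *-identityˡ _ ⟩
        κ * w                          ∎
        where open ≤-Reasoning

      ∣angle∣≤κ : ∀ j → ∣ angle j ∣≤ κ
      ∣angle∣≤κ j = ∣∣≤-weaken
        (≤-trans (angle≤κw j) (≤-trans (*-monoʳ-≤ 0≤κ w≤1) (≤-reflexive (*-identityʳ κ))))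
        (∣x∣≤x (0≤angle j))

      open SmallAngles 0≤κ 2κ≤1

    point : Fin (suc n) → ℂ
    point j = cis (∣angle∣≤κ j)

    point∈γ : ∀ j → γ π L 1≤L (point j)
    point∈γ j = angle j
      , ≤-by-difference (0≤x+y (0≤angle j) 0≤πw)
          (solve 2 (λ x y → x :- (:- y) := x :+ y) refl (angle j) (π * w))
      , ≤-trans (angle≤κw j) κw≤πw
      , isCis (∣angle∣≤κ j)
      where
      κw≤πw : κ * w ≤ π * w
      κw≤πw = *-monoˡ-≤ (<⇒≤ 0<w) κ≤π
      0≤πw = ≤-trans 0≤κw κw≤πw

    bounded : ∀ j → normSq (point j) ≤ fromℕ 8
    bounded j = normSq-cis (∣angle∣≤κ j)

    -- Sines of distinct grid angles differ by at least δ / 2, and q δ = 2, so q times the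
    -- difference is at least 1. Distances enter squared, hence S = q².
    q S : Carrier
    q = fromℕ 2 * (fromℕ m * (fromℕ (suc n) * L))
    S = q * q

    1≤S : 1# ≤ S
    1≤S = 1≤x*y 1≤q 1≤q
      where
      1≤q : 1# ≤ q
      1≤q = 1≤x*y (1≤fromℕ 2) (1≤x*y (1≤fromℕ m {{ℕ.>-nonZero (ℕ.<-≤-trans (ℕ.s≤s ℕ.z≤n) 4≤m)}})
        (1≤x*y (1≤fromℕ (suc n)) 1≤L))

    private
      qδ≈2 : q * δ ≈ fromℕ 2
      qδ≈2 = trans
        (solve 7 (λ t m k L u κ w → (t :* (m :* (k :* L))) :* (u :* (κ :* w))
            := t :* ((m :* κ) :* ((k :* u) :* (L :* w))))
          refl (fromℕ 2) (fromℕ m) (fromℕ (suc n)) L u κ w)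
        (trans (*-congˡ (*-cong (recip-inverseʳ (fromℕ m) 0<m)
          (*-cong (recip-inverseʳ (fromℕ (suc n)) (fromℕ-positive (suc n))) (recip-inverseʳ L 0<L))))
          (solve 0 (con (+ 2) :* (:1 :* (:1 :* :1)) := con (+ 2)) refl))

      separated-< : ∀ i j → toℕ i ℕ.< toℕ j → 1# ≤ S * normSq (point j ℂᵣ.+ ℂᵣ.- point i)
      separated-< i j i<j = begin
        1#                        ≤⟨ 1≤x*y 1≤qy 1≤qy ⟩
        (q * y) * (q * y)         ≈⟨ solve 2 (λ q y → (q :* y) :* (q :* y) := (q :* q) :* (y :* y)) refl q y ⟩
        S * (y * y)               ≤⟨ *-monoʳ-≤ (≤-trans 0≤1 1≤S) (≤-by-difference (0≤x² x)
                                       (solve 2 (λ x y → (x :* x :+ y :* y) :- y :* y := x :* x) refl x y)) ⟩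
        S * (x * x + y * y)       ∎
        where
        open ≤-Reasoning
        x = re (point j) - re (point i)
        y = im (point j) - im (point i)
        D = angle j - angle i

        δ≤D : δ ≤ D
        δ≤D = ≤-by-difference
          (0≤x*y (x≤y⇒0≤y-x (fromℕ-mono-≤ i<j)) (<⇒≤ 0<δ))
          (solve 3 (λ i j δ → (j :* δ :- i :* δ) :- δ := (j :- (:1 :+ i)) :* δ) refl
            (fromℕ (toℕ i)) (fromℕ (toℕ j)) δ)

        0≤D = ≤-trans (<⇒≤ 0<δ) δ≤D

        δ≤2y : δ ≤ y + y
        δ≤2y = ≤-trans δ≤D (≤-by-difference
          (0≤x+y (0≤x+y lower lower) (0≤x*y 0≤D (x≤y⇒0≤y-x 4κ≤1)))
          (solve 3 (λ y D κ → (y :+ y) :- D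
              := (((y :- D) :- (:- (D :* (κ :+ κ)))) :+ ((y :- D) :- (:- (D :* (κ :+ κ)))))
                 :+ D :* (:1 :- con (+ 4) :* κ)) refl y D κ))
          where
          lower = x≤y⇒0≤y-x (proj₁ (sin-difference (∣angle∣≤κ j) (∣angle∣≤κ i) (∣x∣≤x 0≤D)))

        1≤qy : 1# ≤ q * y
        1≤qy = *-cancelˡ-≤ (fromℕ-positive 2) (begin
          fromℕ 2 * 1#         ≈⟨ *-identityʳ _ ⟩
          fromℕ 2              ≈⟨ qδ≈2 ⟨
          q * δ                ≤⟨ *-monoʳ-≤ 0≤q δ≤2y ⟩
          q * (y + y)          ≈⟨ solve 2 (λ q y → q :* (y :+ y) := con (+ 2) :* (q :* y)) refl q y ⟩
          fromℕ 2 * (q * y)    ∎)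
          where
          0≤q = 0≤x*y (0≤fromℕ 2) (0≤x*y (0≤fromℕ m) (0≤x*y (0≤fromℕ (suc n)) (<⇒≤ 0<L)))

    separated : ∀ i j → i ≢ j → 1# ≤ S * normSq (point i ℂᵣ.+ ℂᵣ.- point j)
    separated i j i≢j = by-order (ℕ.<-cmp (toℕ i) (toℕ j))
      where
      by-order : _ → 1# ≤ S * normSq (point i ℂᵣ.+ ℂᵣ.- point j)
      by-order (tri< i<j _ _) = ≤-trans (separated-< i j i<j) (≤-reflexive (*-congˡ
        (solve 4 (λ a b c d → (a :- c) :* (a :- c) :+ (b :- d) :* (b :- d) := (c :- a) :* (c :- a) :+ (d :- b) :* (d :- b))
          refl (re (point j)) (im (point j)) (re (point i)) (im (point i)))))
      by-order (tri≈ _ i≡j _) = ⊥-elim (i≢j (Fin.toℕ-injective i≡j))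
      by-order (tri> _ _ j<i) = separated-< j i j<i

  normSq-constant : ∀ {d} (a : Vec (Fin 1) d → ℤ) z k → normSq (evaluate a z) ≈ normSq (ofℤ (a k))
  normSq-constant a z [] = normSq-cong {evaluate a z} {ofℤ (a [])} (ℂᶜ.*-identityʳ (ofℤ (a [])))
  normSq-constant a z (zero ∷ k) = trans
    (normSq-cong {evaluate a z} {tail} (ℂᶜ.trans (evaluate-suc a z) (x+y*0≈x tail (z zero))))
    (normSq-constant (λ k → a (zero ∷ k)) (z ∘ suc) k)
    where
    tail : ℂ
    tail = evaluate (λ k → a (zero ∷ k)) (z ∘ suc)

  normSq-nonzero : ∀ i → i ≡ 0ℤ ⊎ i ≡ 1ℤ ⊎ i ≡ -1ℤ → i ≢ 0ℤ → normSq (ofℤ i) ≈ 1#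
  normSq-nonzero i (inj₁ i≡0) i≢0 = ⊥-elim (i≢0 i≡0)
  normSq-nonzero i (inj₂ i≡±1) _ = normSq-±1 i i≡±1

  maxModulus≥-intro : ∀ {a s} {A : Set a} (S : A → Set s) (f : A → ℂ) {b r} z →
                      S z → IsModulus (f z) r → b ≤ r → MaxModulus≥ S f b
  maxModulus≥-intro S f {r = r} z z∈S isModulus b≤r = z , z∈S , r , isModulus , b≤r

  -- The constant C and the comparison of b with the values at grid points.

  module Bound {π m} (1<mπ : 1# < fromℕ m * π) (4≤m : 4 ℕ.≤ m) (d : ℕ) where

    private
      K C′ : Carrier
      K = fromℕ 18 * (fromℕ 2 * fromℕ m)
      -- Reaching Y takes the exponent d N (K λ₂ + 2 λ₂) with λ₂ = 2 L log N, which is d (2K + 4)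
      -- times L N log N.
      C′ = fromℕ d * ((K + K) + fromℕ 4)

      0≤K : 0# ≤ K
      0≤K = 0≤x*y (0≤fromℕ 18) (0≤x*y (0≤fromℕ 2) (0≤fromℕ m))

      0≤C′ : 0# ≤ C′
      0≤C′ = 0≤x*y (0≤fromℕ d) (0≤x+y (0≤x+y 0≤K 0≤K) (0≤fromℕ 4))

    C : Carrier
    C = 1# + C′

    0<C : 0# < C
    0<C = 0<x+y 0<1 0≤C′

    module _ {n ℓ L b} (1≤L : 1# ≤ L) (log : expΣ ℓ ⟶ fromℕ (suc n))
      (exp : expΣ (- (C * (L * fromℕ (suc n) * ℓ))) ⟶ b) where

      private
        N X : Carrier
        N = fromℕ (suc n)
        X = C * (L * N * ℓ)
        0≤N = 0≤fromℕ (suc n)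
        0≤L = ≤-trans 0≤1 1≤L

        0≤ℓ : 0# ≤ ℓ
        0≤ℓ = 1≤exp⇒0≤ log (1≤fromℕ (suc n))

        0≤LNℓ : 0# ≤ L * N * ℓ
        0≤LNℓ = 0≤x*y (0≤x*y 0≤L 0≤N) 0≤ℓ

        b*expΣ≤1 : ∀ M → b * expΣ X M ≤ 1#
        b*expΣ≤1 = ExpNegation.limit-*-expΣ≤1 (0≤x*y (<⇒≤ 0<C) 0≤LNℓ) exp

      -- Settles the constant polynomial, whose modulus is 1; the one-term partial sum suffices.
      b≤1 : b ≤ 1#
      b≤1 = ≤-trans (≤-reflexive (solve 1 (λ b → b := b :* (:1 :+ con 0ℤ)) refl b)) (b*expΣ≤1 1)

      Y₀ : Carrier
      Y₀ = K * (N * L)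

      0<Y₀ : 0# < Y₀
      0<Y₀ = *-positive (*-positive (fromℕ-positive 18)
        (*-positive (fromℕ-positive 2) (<-≤-trans (fromℕ-positive 4) (fromℕ-mono-≤ 4≤m))))
        (*-positive (fromℕ-positive (suc n)) (1≤x⇒0<x 1≤L))

      -- 1 / Y is the modulus guaranteed at some grid point: Y² dominates `loss (suc n) ^ d`.
      Y : Carrier
      Y = (Y₀ ^ suc n) ^ d

      0<Y : 0# < Y
      0<Y = 0<x^n d (0<x^n (suc n) 0<Y₀)

      module _ (2≤N : fromℕ 2 ≤ N) where

        private
          -- A common exponent for the factors of Y₀: as 2 log N ≥ 1 and L ≥ 1, it is at least 1, L
          -- and 2 log N.
          λ₂ : Carrier
          λ₂ = L * ℓ + L * ℓ

          0≤Lℓ = 0≤x*y 0≤L 0≤ℓ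
          0≤λ₂ = 0≤x+y 0≤Lℓ 0≤Lℓ

          ℓ≤Lℓ : ℓ ≤ L * ℓ
          ℓ≤Lℓ = ≤-trans (≤-reflexive (sym (*-identityˡ ℓ))) (*-monoˡ-≤ 0≤ℓ 1≤L)

          1≤2ℓ : 1# ≤ ℓ + ℓ
          1≤2ℓ = 2≤exp⇒1≤2x log 2≤N

          reaches-L : Reaches λ₂ L
          reaches-L = reaches-≤ 0≤L (≤-trans (≤-reflexive (sym (*-identityʳ L)))
            (≤-trans (*-monoʳ-≤ 0≤L 1≤2ℓ) (≤-reflexive (distribˡ L ℓ ℓ))))

          reaches-N : Reaches λ₂ N
          reaches-N = reaches-mono (0≤x+y 0≤ℓ 0≤ℓ) (+-mono-≤ ℓ≤Lℓ ℓ≤Lℓ) (reaches-limit log 2≤N 0≤ℓ)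

          reaches-K : Reaches (K * λ₂) K
          reaches-K = reaches-≤ 0≤K (≤-trans (≤-reflexive (sym (*-identityʳ K)))
            (*-monoʳ-≤ 0≤K (≤-trans 1≤2ℓ (+-mono-≤ ℓ≤Lℓ ℓ≤Lℓ))))

          0≤2λ₂ = 0≤x+y 0≤λ₂ 0≤λ₂
          0≤Kλ₂ = 0≤x*y 0≤K 0≤λ₂
          0≤x₀ = 0≤x+y 0≤Kλ₂ 0≤2λ₂

          reaches-Y₀ : Reaches (K * λ₂ + (λ₂ + λ₂)) Y₀
          reaches-Y₀ = reaches-* 0≤Kλ₂ 0≤2λ₂ 0≤K reaches-K (reaches-* 0≤λ₂ 0≤λ₂ 0≤N reaches-N reaches-L)

          reaches-Y : Reaches (fromℕ d * (N * (K * λ₂ + (λ₂ + λ₂)))) Y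
          reaches-Y = reaches-^ (0≤x*y 0≤N 0≤x₀) (0≤x^n (suc n) (<⇒≤ 0<Y₀))
            (reaches-^ 0≤x₀ (<⇒≤ 0<Y₀) reaches-Y₀ (suc n)) d

          reaches-X : Reaches X Y
          reaches-X = reaches-mono (0≤x*y (0≤fromℕ d) (0≤x*y 0≤N 0≤x₀))
            (≤-by-difference 0≤LNℓ
              (solve 5 (λ d k n L ℓ →
                  (:1 :+ d :* ((k :+ k) :+ con (+ 4))) :* (L :* n :* ℓ)
                    :- d :* (n :* (k :* (L :* ℓ :+ L :* ℓ) :+ ((L :* ℓ :+ L :* ℓ) :+ (L :* ℓ :+ L :* ℓ))))
                  := L :* n :* ℓ) refl (fromℕ d) K N L ℓ))
            reaches-Y

        0≤b⇒Y*b≤1 : 0# ≤ b → Y * b ≤ 1#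
        0≤b⇒Y*b≤1 0≤b = ≤-trans (≤-reflexive (*-comm Y b))
          (≤-trans (*-monoʳ-≤ 0≤b (proj₂ reaches-X)) (b*expΣ≤1 (proj₁ reaches-X)))

        -- Replacing Y by a partial sum that exceeds it needs b ≥ 0; for b ≤ 0 the claim holds by
        -- sign.
        b≤1/Y : b ≤ recip Y 0<Y
        b≤1/Y = ≤-by-cases {0#} {b}
          (λ 0<b → *-cancelˡ-≤ 0<Y (≤-trans (0≤b⇒Y*b≤1 (<⇒≤ 0<b)) (≤-reflexive (sym (recip-inverseʳ Y 0<Y)))))
          (λ b≤0 → ≤-trans b≤0 (<⇒≤ (recip-positive Y 0<Y)))

      open Grid {π} {m} 1<mπ 4≤m n 1≤L
      open SeparatedPoints 1≤S

      private
        W : Carrier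
        W = recip Y 0<Y
        0<W = recip-positive Y 0<Y

        -- Since N ≥ 1, 4 ≤ 4^N, so the loss is at most (4 A)^N. The 18 in K is chosen for 4 A = 288
        -- q² ≤ 324 q² = Y₀².
        loss≤ : loss (suc n) ≤ Y₀ ^ suc n * Y₀ ^ suc n
        loss≤ = begin
          fromℕ 4 * A ^ suc n           ≤⟨ *-monoˡ-≤ (0≤x^n (suc n) 0≤A) (≤-trans (≤-reflexive (sym (*-identityʳ _)))
                                             (*-monoʳ-≤ (0≤fromℕ 4) (1≤x^n n (1≤fromℕ 4)))) ⟩
          fromℕ 4 ^ suc n * A ^ suc n   ≈⟨ ^-distrib-* (fromℕ 4) A (suc n) ⟨
          (fromℕ 4 * A) ^ suc n         ≤⟨ ^-mono-≤ (suc n) (0≤x*y (0≤fromℕ 4) 0≤A) 4A≤Y₀² ⟩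
          (Y₀ * Y₀) ^ suc n             ≈⟨ ^-distrib-* Y₀ Y₀ (suc n) ⟩
          Y₀ ^ suc n * Y₀ ^ suc n       ∎
          where
          open ≤-Reasoning
          A = fromℕ 72 * S
          0≤A : 0# ≤ A
          0≤A = 0≤x*y (0≤fromℕ 72) (≤-trans 0≤1 1≤S)
          4A≤Y₀² : fromℕ 4 * A ≤ Y₀ * Y₀
          4A≤Y₀² = ≤-by-difference (0≤x*y (0≤fromℕ 36) (≤-trans 0≤1 1≤S))
            (trans (+-congʳ (*-cong Y₀≈ Y₀≈))
              (solve 1 (λ q → (con (+ 18) :* q) :* (con (+ 18) :* q) :- con (+ 4) :* (con (+ 72) :* (q :* q))
                           := con (+ 36) :* (q :* q)) refl q))
            where
            Y₀≈ : Y₀ ≈ fromℕ 18 * q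
            Y₀≈ = solve 5 (λ e t m n L → (e :* (t :* m)) :* (n :* L) := e :* (t :* (m :* (n :* L))))
              refl (fromℕ 18) (fromℕ 2) (fromℕ m) N L

        lossᵈ*W²≤1 : loss (suc n) ^ d * (W * W) ≤ 1#
        lossᵈ*W²≤1 = begin
          loss (suc n) ^ d * (W * W)   ≤⟨ *-monoˡ-≤ (0≤x² W) (^-mono-≤ d 0≤loss loss≤) ⟩
          (Y₀ ^ suc n * Y₀ ^ suc n) ^ d * (W * W)  ≈⟨ *-congʳ (^-distrib-* (Y₀ ^ suc n) (Y₀ ^ suc n) d) ⟩
          (Y * Y) * (W * W)            ≈⟨ solve 2 (λ y w → (y :* y) :* (w :* w) := (y :* w) :* (y :* w)) refl Y W ⟩
          (Y * W) * (Y * W)            ≈⟨ *-cong (recip-inverseʳ Y 0<Y) (recip-inverseʳ Y 0<Y) ⟩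
          1# * 1#                      ≈⟨ *-identityˡ 1# ⟩
          1#                           ∎
          where
          open ≤-Reasoning
          0≤loss : 0# ≤ loss (suc n)
          0≤loss = 0≤x*y (0≤fromℕ 4) (0≤x^n (suc n) (0≤x*y (0≤fromℕ 72) (≤-trans 0≤1 1≤S)))

      InArcs : (Fin d → ℂ) → Set _
      InArcs z = ∀ i → γ π L 1≤L (z i)

      large-modulus : fromℕ 2 ≤ N → (a : Vec (Fin (suc n)) d → ℤ) → ∀ k → normSq (ofℤ (a k)) ≈ 1# →
                      MaxModulus≥ InArcs (evaluate a) b
      large-modulus 2≤N a k unit = found (large-evaluation point bounded separated a (*-positive 0<W 0<W) k
        (≤-trans lossᵈ*W²≤1 (≤-reflexive (sym unit))))
        where
        found : (∃[ σ ] W * W ≤ normSq (evaluate a (point ∘ σ))) → MaxModulus≥ InArcs (evaluate a) b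
        found (σ , W²≤) = with-root (square-root (<-≤-trans (*-positive 0<W 0<W) W²≤))
          where
          with-root : (∃[ r ] (0# ≤ r) × (r * r ≈ normSq (evaluate a (point ∘ σ)))) →
                      MaxModulus≥ InArcs (evaluate a) b
          with-root (r , 0≤r , r²≈) = maxModulus≥-intro InArcs (evaluate a) (point ∘ σ)
            (λ i → point∈γ (σ i)) (0≤r , r²≈) (≤-trans (b≤1/Y 2≤N) W≤r)
            where
            W≤r : W ≤ r
            W≤r r<W = ≤-trans W²≤ (≤-reflexive (sym r²≈))
              (≤-<-trans (*-monoˡ-≤ 0≤r (<⇒≤ r<W)) (*-monoʳ-< 0<W r<W))

      constant-modulus : (a : Vec (Fin 1) d → ℤ) → ∀ k → normSq (ofℤ (a k)) ≈ 1# →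
                         MaxModulus≥ InArcs (evaluate a) b
      constant-modulus a k unit = maxModulus≥-intro InArcs (evaluate a) z (λ _ → point∈γ zero)
        (0≤1 , trans (*-identityˡ 1#) (sym (trans (normSq-constant a z k) unit))) b≤1
        where
        z : Fin d → ℂ
        z _ = point zero

corollary5p1 : ∀ {c ℓ₁ ℓ₂} (ℝ : RealNumbers c ℓ₁ ℓ₂) → let open Analysis ℝ in
    ∀ (π : Carrier) → IsPi π →
    ∀ (d : ℕ) → 1 ℕ.≤ d →
    ∃[ C ] (0# < C) ×
    (∀ (n : ℕ) (a : Vec (Fin n) d → ℤ) →
    (∀ k → a k ≡ 0ℤ ⊎ a k ≡ 1ℤ ⊎ a k ≡ -1ℤ) →
    (∃[ k ] a k ≢ 0ℤ) →
    ∀ (L : Carrier) (1≤L : 1# ≤ L) →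
    ∀ (logn : Carrier) → IsLog (fromℕ n) logn →
    ∀ (b : Carrier) → IsRealExp (- (C * (L * fromℕ n * logn))) b →
    MaxModulus≥ (λ (z : Fin d → ℂ) → ∀ i → γ π L 1≤L (z i)) (evaluate a) b)
corollary5p1 ℝ π (0<π , _) d@(suc _) _ = C , 0<C , λ where
    -- For n = 0 and d ≥ 1 there is no exponent vector, hence no nonzero coefficient.
    ℕ.zero a _ (() ∷ _ , _)
    (suc ℕ.zero) a a∈ (k , ak≢0) L 1≤L ℓ log b exp →
      constant-modulus {0} 1≤L (IsRealExp⇒expΣ log) (IsRealExp⇒expΣ exp) a k (normSq-nonzero (a k) (a∈ k) ak≢0)
    (suc (suc n)) a a∈ (k , ak≢0) L 1≤L ℓ log b exp →
      large-modulus {suc n} 1≤L (IsRealExp⇒expΣ log) (IsRealExp⇒expΣ exp)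
        (fromℕ-mono-≤ {2} {suc (suc n)} (ℕ.s≤s (ℕ.s≤s ℕ.z≤n)))
        a k (normSq-nonzero (a k) (a∈ k) ak≢0)
  where
  open Analysis ℝ
  open RealAnalysis ℝ
  m = proj₁ (archimedean-inverse 0<π)
  -- Adding 4 secures m ≥ 4 and preserves m π > 1.
  open Bound {m = 4 ℕ.+ m} (<-≤-trans (proj₂ (archimedean-inverse 0<π))
    (*-monoˡ-≤ (<⇒≤ 0<π) (fromℕ-mono-≤ (ℕ.m≤n+m m 4)))) (ℕ.m≤m+n 4 m) d
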